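{- Let $f(n)$ be the number of permutations $\pi\in\mathfrak S_n$ all of whose valleys are even and all of whose peaks are odd (with $f(0)=1$), and let $F(x)=\sum_{n\ge0} f(n)\,x^n/n!$. Then \[ F(x)=\frac{3\sin\left(\tfrac{1}{2}x\right)+3\cosh\left(\tfrac{1}{2}\sqrt{3}x\right)}{3\cos\left(\tfrac{1}{2}x\right)-\sqrt{3}\sinh\left(\tfrac{1}{2}\sqrt{3}x\right)}. \]
   Context: $\mathfrak S_n$ is the set of permutations $\pi=\pi_1\pi_2\cdots\pi_n$ of $[n]=\{1,\dots,n\}$. An index $i$ with $2\le i\le n-1$ is a peak of $\pi$ if $\pi_{i-1}<\pi_i>\pi_{i+1}$ and a valley of $\pi$ if $\pi_{i-1}>\pi_i<\pi_{i+1}$. "All valleys even and all peaks odd" means every valley index is an even integer and every peak index is an odd integer. -}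

module Defs where

open import Algebra.Bundles using (CommutativeRing)
open import Algebra.Definitions using (Invertible)
import Algebra.Properties.CommutativeMonoid.Sum as Sum
import Algebra.Properties.Semiring.Exp as Exp
open import Data.Fin.Base as Fin using (Fin; toℕ)
open import Data.Fin.Properties as Fin using (all?; any?)
open import Data.Integer.Base using (ℤ; +_; -_)
open import Data.List.Base using (List; []; _∷_; allFin; cartesianProductWith; filter; length)
open import Data.Nat.Base using (ℕ; zero; suc; _∸_; _!)
open import Data.Nat.Divisibility using (_∣_; _∣?_)
open import Data.Nat.Properties as ℕ using (_!≢0)
open import Data.Product.Base using (Σ; _×_; _,_; ∃-syntax)
open import Data.Rational.Base using (ℚ; _/_)
open import Data.Vec.Base using (Vec; []; _∷_; lookup)
open import Data.Vec.Relation.Unary.AllPairs using (allPairs?)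
open import Data.Vec.Relation.Unary.Unique.Propositional using (Unique)
open import Level using (Level; _⊔_)
open import Relation.Binary.Core using (Rel)
open import Relation.Binary.PropositionalEquality.Core using (_≡_)
open import Relation.Nullary.Decidable using (Dec; ¬?; _×-dec_; _→-dec_)
open import Relation.Nullary.Negation.Core using (¬_)

------------------------------------------------------------------------
-- Permutations in one-line notation: words of length n over an n-letter
-- alphabet without repeated letters. [n] is represented by Fin n, so the
-- position i of a word has 1-based index suc (toℕ i).

Word : ℕ → Set
Word n = Vec (Fin n) n

IsPermutation : ∀ {n} → Word n → Set
IsPermutation = Unique

index : ∀ {n} → Fin n → ℕ
index i = suc (toℕ i)

Even Odd : ℕ → Set
Even m = 2 ∣ m
Odd  m = ¬ (2 ∣ m)

-- The existence of both neighbours h and j of i encodes 2 ≤ index i ≤ n - 1.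

IsPeak : ∀ {n} → Word n → Fin n → Set
IsPeak π i = ∃[ h ] ∃[ j ]
  index i ≡ suc (index h) × index j ≡ suc (index i) ×
  lookup π h Fin.< lookup π i × lookup π j Fin.< lookup π i

IsValley : ∀ {n} → Word n → Fin n → Set
IsValley π i = ∃[ h ] ∃[ j ]
  index i ≡ suc (index h) × index j ≡ suc (index i) ×
  lookup π i Fin.< lookup π h × lookup π i Fin.< lookup π j

ValleysEven PeaksOdd : ∀ {n} → Word n → Set
ValleysEven π = ∀ i → IsValley π i → Even (index i)
PeaksOdd    π = ∀ i → IsPeak π i → Odd (index i)

Counted : ∀ {n} → Word n → Set
Counted π = IsPermutation π × ValleysEven π × PeaksOdd π

isPeak? : ∀ {n} (π : Word n) i → Dec (IsPeak π i)
isPeak? π i = any? λ h → any? λ j →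
  (index i ℕ.≟ suc (index h)) ×-dec (index j ℕ.≟ suc (index i)) ×-dec
  (lookup π h Fin.<? lookup π i) ×-dec (lookup π j Fin.<? lookup π i)

isValley? : ∀ {n} (π : Word n) i → Dec (IsValley π i)
isValley? π i = any? λ h → any? λ j →
  (index i ℕ.≟ suc (index h)) ×-dec (index j ℕ.≟ suc (index i)) ×-dec
  (lookup π i Fin.<? lookup π h) ×-dec (lookup π i Fin.<? lookup π j)

counted? : ∀ {n} (π : Word n) → Dec (Counted π)
counted? π =
  allPairs? (λ x y → ¬? (x Fin.≟ y)) π ×-dec
  all? (λ i → isValley? π i →-dec (2 ∣? index i)) ×-dec
  all? (λ i → isPeak? π i →-dec ¬? (2 ∣? index i))

-- Every word of length k over Fin m, each listed exactly once.

words : ∀ m k → List (Vec (Fin m) k)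
words m zero    = [] ∷ []
words m (suc k) = cartesianProductWith _∷_ (allFin m) (words m k)

f : ℕ → ℕ
f n = length (filter counted? (words n n))

------------------------------------------------------------------------
-- Formal power series: a n is the coefficient of xⁿ.

module PowerSeries {c ℓ : Level} (R : CommutativeRing c ℓ) where

  open CommutativeRing R hiding (-_)
  open Sum +-commutativeMonoid using (sum)
  open Exp semiring using (_^_)

  Series : Set c
  Series = ℕ → Carrier

  infix  4 _≋_
  infix  4 _≋_÷_
  infixl 6 _⊕_ _⊖_
  infixr 7 _·_
  infixl 7 _⊛_

  _≋_ : Rel Series ℓ
  a ≋ b = ∀ n → a n ≈ b n

  _⊕_ _⊖_ _⊛_ : Series → Series → Series
  (a ⊕ b) n = a n + b n
  (a ⊖ b) n = a n - b n
  (a ⊛ b) n = sum λ (k : Fin (suc n)) → a (toℕ k) * b (n ∸ toℕ k)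

  1ˢ : Series
  1ˢ zero    = 1#
  1ˢ (suc _) = 0#

  _·_ : Carrier → Series → Series
  (r · a) n = r * a n

  -- a [ r x] is the series a(r x).
  _[_x] : Series → Carrier → Series
  (a [ r x]) n = r ^ n * a n

  -- a ≋ b ÷ d: the series d is invertible and a is b d⁻¹.
  _≋_÷_ : Series → Series → Series → Set (c ⊔ ℓ)
  a ≋ b ÷ d = Σ (Invertible _≋_ 1ˢ _⊛_ d) λ (d⁻¹ , _) → a ≋ b ⊛ d⁻¹

  module Exponential (ι : ℚ → Carrier) where

    -- The series Σ aₙ xⁿ / n!, with rational coefficients mapped to R by ι.
    egf : (ℕ → ℤ) → Series
    egf a n = ι (_/_ (a n) (n !) {{n !≢0}})

    sin cos sinh cosh F : Series

    sin = egf a where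
      a : ℕ → ℤ
      a 0             = + 0
      a 1             = + 1
      a (suc (suc n)) = - a n

    cos = egf a where
      a : ℕ → ℤ
      a 0             = + 1
      a 1             = + 0
      a (suc (suc n)) = - a n

    sinh = egf a where
      a : ℕ → ℤ
      a 0             = + 0
      a 1             = + 1
      a (suc (suc n)) = a n

    cosh = egf a where
      a : ℕ → ℤ
      a 0             = + 1
      a 1             = + 0
      a (suc (suc n)) = a n

    F = egf λ n → + f n

{-# OPTIONS --safe #-}
module Submission where

-- Call the step from π i to π (i + 1) an alternating descent if it is a descent and i is odd, or an
-- ascent and i is even. The conditions on peaks and valleys say that, of two consecutive steps, at
-- least one is an alternating descent, so valid words can be counted by their first letter, the state
-- being the parity of its position and whether the first step is forced to be an alternating descent.
-- Index these counts by the numbers of letters smaller and larger than the first one, and let U, Z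
-- (odd start; first step free, forced) and Ū, Z̄ (even start) be their exponential generating functions
-- in x and y. Comparing neighbouring first letters gives, for δ = ∂/∂x − ∂/∂y,
--   δU = Ū − Z̄,  δZ = Ū,  δŪ = Z − U,  δZ̄ = −U.
-- Put c = cos (t/2), s = sin (t/2), C = cosh (√3 t/2), S = √3 sinh (√3 t/2). Then
--   J = (Z − 2U) S(x) c(y) + 3 Z C(x) s(y) + (Z̄ − 2Ū) S(x) s(y) − 3 Z̄ C(x) c(y)
-- satisfies δJ = 0, so J depends only on x + y. Since U(t,0) = Z(t,0) = Z̄(0,t) = F(t) and
-- Z(0,t) = Z̄(t,0) = 1, the equation J(t,0) = J(0,t) reads F (3c − S) = 3s + 3C.

open import Algebra.Bundles using (CommutativeRing)
open import Algebra.Definitions using (Invertible)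
open import Algebra.Morphism.Structures using (module RingMorphisms)
import Algebra.Properties.CommutativeMonoid.Sum
import Algebra.Properties.Group
import Algebra.Properties.Semiring.Exp
import Algebra.Solver.Ring
open import Algebra.Solver.Ring.AlmostCommutativeRing using (fromCommutativeRing; _-Raw-AlmostCommutative⟶_)
open import Data.Bool.Base using (Bool; true; false; not; if_then_else_; T)
open import Data.Bool.Properties using (if-not; T-≡; ¬-not)
open import Data.Empty using (⊥-elim)
open import Data.Fin.Base as Fin using (Fin; zero; suc; toℕ; punchIn; opposite)
open import Data.Fin.Patterns using (0F; 1F; 2F)
open import Data.Fin.Permutation using (reverse)
import Data.Fin.Properties as Fin
open import Data.Integer.Base as ℤ using (ℤ; -[1+_])
import Data.Integer.Properties as ℤ
open import Data.List.Base as List using (List; []; _∷_; _++_; tabulate; cartesianProductWith; filter; length)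
open import Data.List.Properties using (length-++; filter-++)
open import Data.Maybe.Base using (Maybe; just; nothing)
open import Data.Nat.Base as ℕ using (ℕ; zero; suc; _<ᵇ_; s≤s; _!)
open import Data.Nat.Divisibility using (divides)
open import Data.Nat.Properties as ℕ using (_!≢0)
open import Data.Product.Base using (Σ; _×_; _,_; proj₁; proj₂; ∃-syntax)
open import Data.Rational.Base as ℚ using (ℚ; 0ℚ; 1ℚ; ½; _/_; toℚᵘ; +-*-rawRing)
import Data.Rational.Properties as ℚ
open import Data.Rational.Unnormalised.Base as ℚᵘ using (mkℚᵘ; *≡*)
import Data.Rational.Unnormalised.Properties as ℚᵘ
open import Data.Unit.Base using (⊤; tt)
open import Data.Vec.Base as Vec using (Vec; []; _∷_; lookup)
open import Data.Vec.Relation.Unary.All using (All; []; _∷_)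
open import Data.Vec.Relation.Unary.AllPairs using ([]; _∷_)
open import Data.Vec.Relation.Unary.Unique.Propositional using (Unique)
open import Function.Base using (_∘_; id)
open import Function.Bundles using (Equivalence)
open import Level using (Level)
open import Relation.Binary.PropositionalEquality as ≡ using (_≡_; _≢_; _≗_)
open import Relation.Nullary using (Dec; yes; no; does; ¬_; contradiction; ¬?)
open import Relation.Unary using (Decidable)
open import Defs

module Enumeration where

  open import Algebra.Properties.CommutativeMonoid.Sum ℕ.+-0-commutativeMonoid
    using (sum; sum-cong-≗; sum-remove; sum-permute; sum-replicate-zero)
  open import Data.Nat.Base using (_+_; _*_; _<_; _≤_)
  open ≡ using (refl; sym; trans; cong; cong₂; subst)
  open ≡.≡-Reasoning

  private variable
    k m n : ℕ

  -- Indicators with values 0 and 1.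

  data Indicates (P : Set) : ℕ → Set where
    holds : P → Indicates P 1
    fails : ¬ P → Indicates P 0

  ⟦_⟧ : {P : Set} → Dec P → ℕ
  ⟦ P? ⟧ = if does P? then 1 else 0

  ⟦⟧-indicates : {P : Set} (P? : Dec P) → Indicates P ⟦ P? ⟧
  ⟦⟧-indicates (yes p) = holds p
  ⟦⟧-indicates (no ¬p) = fails ¬p

  indicates-unique : ∀ {P Q : Set} {a b} → (P → Q) → (Q → P) →
                     Indicates P a → Indicates Q b → a ≡ b
  indicates-unique to from (holds p) (holds q) = refl
  indicates-unique to from (holds p) (fails ¬q) = contradiction (to p) ¬q
  indicates-unique to from (fails ¬p) (holds q) = contradiction (from q) ¬p
  indicates-unique to from (fails ¬p) (fails ¬q) = refl

  indicates-⇔ : ∀ {P Q : Set} {a} → (P → Q) → (Q → P) → Indicates P a → Indicates Q a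
  indicates-⇔ to from (holds p)  = holds (to p)
  indicates-⇔ to from (fails ¬p) = fails (¬p ∘ from)

  -- The second factor need only be an indicator once `P` holds, since otherwise the product is 0.
  -- This allows `weight` to be analysed for words with distinct letters only.
  indicates-× : ∀ {P Q : Set} {a b} → Indicates P a → (P → Indicates Q b) → Indicates (P × Q) (a * b)
  indicates-× (fails ¬p) ind = fails (¬p ∘ proj₁)
  indicates-× (holds p) ind with ind p
  ... | holds q  = holds (p , q)
  ... | fails ¬q = fails (¬q ∘ proj₂)

  -- Sums over words

  -- The nested sums follow the recursion of `words`, so that counting becomes summation over one
  -- letter at a time.
  W : ∀ m k → (Vec (Fin m) k → ℕ) → ℕ
  W m zero    q = q []
  W m (suc k) q = sum λ a → W m k (q ∘ (a ∷_))

  W-cong : ∀ k {q q′ : Vec (Fin m) k → ℕ} → q ≗ q′ → W m k q ≡ W m k q′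
  W-cong zero    q≗q′ = q≗q′ []
  W-cong (suc k) q≗q′ = sum-cong-≗ λ a → W-cong k (q≗q′ ∘ (a ∷_))

  W-zero : ∀ m k → W m k (λ _ → 0) ≡ 0
  W-zero m zero    = refl
  W-zero m (suc k) = trans (sum-cong-≗ {m} λ a → W-zero m k) (sum-replicate-zero m)

  length-filter-map : ∀ {A B : Set} {P : B → Set} (P? : Decidable P) (g : A → B) xs →
                      length (filter P? (List.map g xs)) ≡ length (filter (P? ∘ g) xs)
  length-filter-map P? g [] = refl
  length-filter-map P? g (x ∷ xs) with does (P? (g x))
  ... | true  = cong suc (length-filter-map P? g xs)
  ... | false = length-filter-map P? g xs

  length-filter-product : ∀ {A B C : Set} {P : C → Set} (P? : Decidable P) (_∙_ : A → B → C)
                          (g : Fin k → A) ys →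
    length (filter P? (cartesianProductWith _∙_ (tabulate g) ys)) ≡
    sum λ i → length (filter (P? ∘ (g i ∙_)) ys)
  length-filter-product {k = zero}  P? _∙_ g ys = refl
  length-filter-product {k = suc k} P? _∙_ g ys = begin
    length (filter P? (xs ++ rest))                    ≡⟨ cong length (filter-++ P? xs rest) ⟩
    length (filter P? xs ++ filter P? rest)            ≡⟨ length-++ (filter P? xs) ⟩
    length (filter P? xs) + length (filter P? rest)    ≡⟨ cong₂ _+_ (length-filter-map P? (g zero ∙_) ys)
                                                            (length-filter-product P? _∙_ (g ∘ suc) ys) ⟩
    _                                                  ∎
    where
    xs   = List.map (g zero ∙_) ys
    rest = cartesianProductWith _∙_ (tabulate (g ∘ suc)) ys

  length-filter-words : ∀ {P : Vec (Fin m) k → Set} (P? : Decidable P) →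
                        length (filter P? (words m k)) ≡ W m k (⟦_⟧ ∘ P?)
  length-filter-words {k = zero} P? with does (P? [])
  ... | true  = refl
  ... | false = refl
  length-filter-words {m} {suc k} P? =
    trans (length-filter-product P? _∷_ id (words m k))
          (sum-cong-≗ λ a → length-filter-words (P? ∘ (a ∷_)))

  -- Words without repeated letters, and relabelling by `punchIn`.

  distinct : Fin m → Fin m → ℕ
  distinct x y = ⟦ ¬? (x Fin.≟ y) ⟧

  avoids : Fin m → Vec (Fin m) k → ℕ
  avoids x []      = 1
  avoids x (y ∷ v) = distinct x y * avoids x v

  unique : Vec (Fin m) k → ℕ
  unique []      = 1
  unique (x ∷ v) = avoids x v * unique v

  avoids-indicates : (x : Fin m) (v : Vec (Fin m) k) → Indicates (All (x ≢_) v) (avoids x v)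
  avoids-indicates x []      = holds []
  avoids-indicates x (y ∷ v) = indicates-⇔ (λ (p , q) → p ∷ q) (λ { (p ∷ q) → p , q })
    (indicates-× (⟦⟧-indicates (¬? (x Fin.≟ y))) λ _ → avoids-indicates x v)

  unique-indicates : (v : Vec (Fin m) k) → Indicates (Unique v) (unique v)
  unique-indicates []      = holds []
  unique-indicates (x ∷ v) = indicates-⇔ (λ (p , q) → p ∷ q) (λ { (p ∷ q) → p , q })
    (indicates-× (avoids-indicates x v) λ _ → unique-indicates v)

  distinct-refl : (x : Fin m) → distinct x x ≡ 0
  distinct-refl x = indicates-unique (λ x≢x → x≢x refl) ⊥-elim (⟦⟧-indicates (¬? (x Fin.≟ x))) (fails id)

  distinct-punchIn : (x : Fin (suc m)) (j : Fin m) → distinct x (punchIn x j) ≡ 1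
  distinct-punchIn x j = indicates-unique (λ _ → tt) (λ _ → Fin.punchInᵢ≢i x j ∘ sym)
    (⟦⟧-indicates (¬? (x Fin.≟ punchIn x j))) (holds tt)

  -- Words that avoid `x` are the images under `punchIn x` of words over one letter fewer: at each
  -- place the summand at `x` vanishes and `punchIn x` enumerates the others.
  W-avoids : ∀ k (x : Fin (suc m)) (q : Vec (Fin (suc m)) k → ℕ) →
             W (suc m) k (λ v → avoids x v * q v) ≡ W m k (q ∘ Vec.map (punchIn x))
  W-avoids zero    x q = ℕ.+-identityʳ _
  W-avoids {m} (suc k) x q = begin
    sum t                              ≡⟨ sum-remove {i = x} t ⟩
    t x + sum (t ∘ punchIn x)          ≡⟨ cong₂ _+_ tx≡0 (sum-cong-≗ λ j → trans (W-cong k (λ v →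
                                            cong (λ d → d * avoids x v * q (punchIn x j ∷ v)) (distinct-punchIn x j)))
                                            (trans (W-cong k λ v → cong (_* q (punchIn x j ∷ v))
                                                (ℕ.*-identityˡ (avoids x v))) (W-avoids k x (q ∘ (punchIn x j ∷_))))) ⟩
    W m (suc k) (q ∘ Vec.map (punchIn x)) ∎
    where
    t : Fin (suc m) → ℕ
    t a = W (suc m) k λ v → distinct x a * avoids x v * q (a ∷ v)
    tx≡0 : t x ≡ 0
    tx≡0 = trans (W-cong k λ v → cong (λ d → d * avoids x v * q (x ∷ v)) (distinct-refl x)) (W-zero (suc m) k)

  unique-punchIn : (x : Fin (suc m)) (v : Vec (Fin m) k) → unique (Vec.map (punchIn x) v) ≡ unique v
  unique-punchIn x []      = refl
  unique-punchIn x (y ∷ v) = cong₂ _*_ (avoids-punchIn v) (unique-punchIn x v)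
    where
    avoids-punchIn : ∀ {k} (v : Vec _ k) → avoids (punchIn x y) (Vec.map (punchIn x) v) ≡ avoids y v
    avoids-punchIn []      = refl
    avoids-punchIn (z ∷ v) = cong₂ _*_
      (indicates-unique (λ ne → ne ∘ cong (punchIn x)) (λ ne → ne ∘ Fin.punchIn-injective x y z)
        (⟦⟧-indicates (¬? (punchIn x y Fin.≟ punchIn x z))) (⟦⟧-indicates (¬? (y Fin.≟ z))))
      (avoids-punchIn v)

  -- The flag o tells whether x is at an odd position.
  altDescent : Bool → Fin m → Fin m → Bool
  altDescent true  x y = toℕ y <ᵇ toℕ x
  altDescent false x y = toℕ x <ᵇ toℕ y

  -- The indicator of the words x ∷ v in which no two consecutive steps both fail to be alternating
  -- descents and, if z holds, the first step does not fail.
  weight : Bool → Bool → Fin m → Vec (Fin m) k → ℕ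
  weight o z x []      = 1
  weight o z x (y ∷ v) =
    if altDescent o x y then weight (not o) false y v
    else if z then 0 else weight (not o) true y v

  <ᵇ-punchIn : (x : Fin (suc m)) (y z : Fin m) →
               (toℕ (punchIn x y) <ᵇ toℕ (punchIn x z)) ≡ (toℕ y <ᵇ toℕ z)
  <ᵇ-punchIn zero    y       z       = refl
  <ᵇ-punchIn (suc x) zero    zero    = refl
  <ᵇ-punchIn (suc x) zero    (suc z) = refl
  <ᵇ-punchIn (suc x) (suc y) zero    = refl
  <ᵇ-punchIn (suc x) (suc y) (suc z) = <ᵇ-punchIn x y z

  -- Letters below the pivot stay fixed, and all others are raised above it.
  punchIn-<ᵇ-pivot : (x : Fin (suc m)) (j : Fin m) → (toℕ (punchIn x j) <ᵇ toℕ x) ≡ (toℕ j <ᵇ toℕ x)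
  punchIn-<ᵇ-pivot zero    j       = refl
  punchIn-<ᵇ-pivot (suc x) zero    = refl
  punchIn-<ᵇ-pivot (suc x) (suc j) = punchIn-<ᵇ-pivot x j

  pivot-<ᵇ-punchIn : (x : Fin (suc m)) (j : Fin m) → (toℕ x <ᵇ toℕ (punchIn x j)) ≡ not (toℕ j <ᵇ toℕ x)
  pivot-<ᵇ-punchIn zero    j       = refl
  pivot-<ᵇ-punchIn (suc x) zero    = refl
  pivot-<ᵇ-punchIn (suc x) (suc j) = pivot-<ᵇ-punchIn x j

  altDescent-punchIn : ∀ o (x : Fin (suc m)) y z →
                       altDescent o (punchIn x y) (punchIn x z) ≡ altDescent o y z
  altDescent-punchIn true  x y z = <ᵇ-punchIn x z y
  altDescent-punchIn false x y z = <ᵇ-punchIn x y z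

  -- The weight depends only on the relative order of the letters, which `punchIn x` preserves.
  weight-punchIn : ∀ o z (x : Fin (suc m)) (y : Fin m) (v : Vec (Fin m) k) →
                   weight o z (punchIn x y) (Vec.map (punchIn x) v) ≡ weight o z y v
  weight-punchIn o z x y [] = refl
  weight-punchIn o z x y (w ∷ v)
    rewrite altDescent-punchIn o x y w | weight-punchIn (not o) false x w v | weight-punchIn (not o) true x w v = refl

  -- Recursion on the first letter.

  split : ∀ N → ℕ → (ℕ → ℕ) → (ℕ → ℕ) → ℕ
  split N k a b = sum λ (j : Fin N) → if toℕ j <ᵇ k then a (toℕ j) else b (toℕ j)

  unless : Bool → (ℕ → ℕ) → ℕ → ℕ
  unless z a j = if z then 0 else a j

  -- E o z n k is the number of valid words of length suc n whose first letter exceeds k others, where o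
  -- tells whether the word starts at an odd position and z whether its first step is forced to be an
  -- alternating descent.
  E : Bool → Bool → ℕ → ℕ → ℕ
  E o     z zero    k = 1
  E true  z (suc n) k = split (suc n) k (E false false n) (unless z (E false true n))
  E false z (suc n) k = split (suc n) k (unless z (E true true n)) (E true false n)

  -- Deleting the first letter and closing the gap leaves a word over one letter fewer. Comparing
  -- its first letter `j` with `x` tells whether the deleted step was an alternating descent, and
  -- hence whether the next step is free or forced.
  count≡E : ∀ o z n (x : Fin (suc n)) →
            W (suc n) n (λ v → unique (x ∷ v) * weight o z x v) ≡ E o z n (toℕ x)
  count≡E o z zero    x = refl
  count≡E o z (suc n) x = begin
    W (2 + n) (suc n) (λ v → unique (x ∷ v) * weight o z x v)
      ≡⟨ W-cong (suc n) (λ v → ℕ.*-assoc (avoids x v) (unique v) (weight o z x v)) ⟩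
    W (2 + n) (suc n) (λ v → avoids x v * (unique v * weight o z x v))
      ≡⟨ W-avoids (suc n) x (λ v → unique v * weight o z x v) ⟩
    (sum λ j → W (suc n) n λ v → unique (Vec.map (punchIn x) (j ∷ v)) * weight o z x (Vec.map (punchIn x) (j ∷ v)))
      ≡⟨ sum-cong-≗ (λ j → trans (W-cong n λ v →
           cong₂ (λ a b → a * b) (unique-punchIn x (j ∷ v)) (first-step (altDescent o x (punchIn x j)) j v))
           (after (altDescent o x (punchIn x j)) z j)) ⟩
    (sum λ j → if altDescent o x (punchIn x j) then E (not o) false n (toℕ j) else unless z (E (not o) true n) (toℕ j))
      ≡⟨ oriented o ⟩
    E o z (suc n) (toℕ x) ∎
    where
    first-step : ∀ d j v →
      (if d then weight (not o) false (punchIn x j) (Vec.map (punchIn x) v)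
       else if z then 0 else weight (not o) true (punchIn x j) (Vec.map (punchIn x) v)) ≡
      (if d then weight (not o) false j v else if z then 0 else weight (not o) true j v)
    first-step d j v rewrite weight-punchIn (not o) false x j v | weight-punchIn (not o) true x j v = refl

    after : ∀ d z j →
      W (suc n) n (λ v → unique (j ∷ v) * (if d then weight (not o) false j v else if z then 0 else weight (not o) true j v)) ≡
      (if d then E (not o) false n (toℕ j) else unless z (E (not o) true n) (toℕ j))
    after true  z     j = count≡E (not o) false n j
    after false false j = count≡E (not o) true n j
    after false true  j = trans (W-cong n λ v → ℕ.*-zeroʳ (unique (j ∷ v))) (W-zero (suc n) n)

    oriented : ∀ o →
      (sum λ (j : Fin (suc n)) →
        if altDescent o x (punchIn x j) then E (not o) false n (toℕ j) else unless z (E (not o) true n) (toℕ j)) ≡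
      E o z (suc n) (toℕ x)
    oriented true  = sum-cong-≗ λ j →
      cong (λ d → if d then E false false n (toℕ j) else unless z (E false true n) (toℕ j)) (punchIn-<ᵇ-pivot x j)
    -- At an even position an alternating descent goes up, so the test is negated and the two
    -- branches change places.
    oriented false = sum-cong-≗ λ j →
      trans (cong (λ d → if d then E true false n (toℕ j) else unless z (E true true n) (toℕ j)) (pivot-<ᵇ-punchIn x j))
            (if-not (toℕ j <ᵇ toℕ x))

  -- Peaks and valleys

  module _ {m k : ℕ} (w : Vec (Fin m) k) (i : Fin k) where

    -- Separating the word length from the alphabet size makes the notions apply to tails; for equal
    -- sizes they unfold to the same types as `IsPeak` and `IsValley`.
    Peak Valley : Set
    Peak = ∃[ h ] ∃[ j ]
      index i ≡ suc (index h) × index j ≡ suc (index i) ×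
      lookup w h Fin.< lookup w i × lookup w j Fin.< lookup w i
    Valley = ∃[ h ] ∃[ j ]
      index i ≡ suc (index h) × index j ≡ suc (index i) ×
      lookup w i Fin.< lookup w h × lookup w i Fin.< lookup w j

  -- The word w is read as a factor preceded by s further letters.
  Admissible : ℕ → Vec (Fin m) k → Set
  Admissible s w = (∀ i → Valley w i → Even (s + index i)) × (∀ i → Peak w i → Odd (s + index i))

  -- This is the only condition that involves `x`: the one at `y`, whose position in the whole word
  -- is 2 + s. Without a third letter `y` is neither a peak nor a valley.
  AdmissibleStart : ℕ → Fin m → Fin m → Vec (Fin m) k → Set
  AdmissibleStart s x y []      = ⊤
  AdmissibleStart s x y (z ∷ _) =
    (y Fin.< x → y Fin.< z → Even (2 + s)) × (x Fin.< y → z Fin.< y → Odd (2 + s))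

  admissible-tail : ∀ s x (w : Vec (Fin m) k) → Admissible s (x ∷ w) → Admissible (suc s) w
  admissible-tail s x w (valleys , peaks) =
    (λ { i (h , j , p , q , r) → subst Even (ℕ.+-suc s (index i))
           (valleys (suc i) (suc h , suc j , cong suc p , cong suc q , r)) }) ,
    (λ { i (h , j , p , q , r) → subst Odd (ℕ.+-suc s (index i))
           (peaks (suc i) (suc h , suc j , cong suc p , cong suc q , r)) })

  admissible-start : ∀ s x y (v : Vec (Fin m) k) → Admissible s (x ∷ y ∷ v) → AdmissibleStart s x y v
  admissible-start s x y []      adm               = tt
  admissible-start s x y (z ∷ v) (valleys , peaks) =
    (λ p q → subst Even (ℕ.+-comm s 2) (valleys 1F (0F , 2F , refl , refl , p , q))) ,
    (λ p q → subst Odd  (ℕ.+-comm s 2) (peaks   1F (0F , 2F , refl , refl , p , q)))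

  admissible-cons : ∀ s x y (v : Vec (Fin m) k) → AdmissibleStart s x y v →
                    Admissible (suc s) (y ∷ v) → Admissible s (x ∷ y ∷ v)
  admissible-cons s x y [] start adm =
    (λ { 0F (_ , _ , () , _) ; 1F (_ , 0F , _ , () , _) ; 1F (_ , 1F , _ , () , _) }) ,
    (λ { 0F (_ , _ , () , _) ; 1F (_ , 0F , _ , () , _) ; 1F (_ , 1F , _ , () , _) })
  admissible-cons s x y (z ∷ v) (start-valley , start-peak) (valleys , peaks) = valleys′ , peaks′
    where
    valleys′ : ∀ i → Valley (x ∷ y ∷ z ∷ v) i → Even (s + index i)
    valleys′ 0F (_ , _ , () , _)
    valleys′ (suc i) (_ , 0F , _ , () , _)
    valleys′ 1F (0F , 2F , _ , _ , p , q) = subst Even (ℕ.+-comm 2 s) (start-valley p q)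
    valleys′ 1F (suc _ , _ , () , _)
    valleys′ 1F (0F , suc (suc (suc _)) , _ , () , _)
    valleys′ 1F (0F , 1F , _ , () , _)
    valleys′ (suc i@(suc _)) (suc h , suc j , p , q , r) = subst Even (sym (ℕ.+-suc s (index i)))
      (valleys i (h , j , ℕ.suc-injective p , ℕ.suc-injective q , r))

    peaks′ : ∀ i → Peak (x ∷ y ∷ z ∷ v) i → Odd (s + index i)
    peaks′ 0F (_ , _ , () , _)
    peaks′ (suc i) (_ , 0F , _ , () , _)
    peaks′ 1F (0F , 2F , _ , _ , p , q) = subst Odd (ℕ.+-comm 2 s) (start-peak p q)
    peaks′ 1F (suc _ , _ , () , _)
    peaks′ 1F (0F , suc (suc (suc _)) , _ , () , _)
    peaks′ 1F (0F , 1F , _ , () , _)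
    peaks′ (suc i@(suc _)) (suc h , suc j , p , q , r) = subst Odd (sym (ℕ.+-suc s (index i)))
      (peaks i (h , j , ℕ.suc-injective p , ℕ.suc-injective q , r))

  admissible-singleton : ∀ s (x : Fin m) → Admissible s (x ∷ [])
  admissible-singleton s x = (λ { 0F (_ , _ , () , _) }) , (λ { 0F (_ , _ , () , _) })

  -- Odd positions are those preceded by an even number of letters.
  even? : ℕ → Bool
  even? zero    = true
  even? (suc s) = not (even? s)

  even-+2 : ∀ {s} → Even s → Even (2 + s)
  even-+2 (divides q eq) = divides (suc q) (cong (2 +_) eq)

  -- In this form a single case distinction on `even? s` fixes both the direction of an alternating
  -- descent and the parity of the position after it.
  even?-sound : ∀ s → if even? s then Even (2 + s) else Odd (2 + s)
  even?-sound zero = divides 1 refl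
  even?-sound 1 = λ { (divides zero ()) ; (divides 1 ()) ; (divides (suc (suc _)) ()) }
  even?-sound (suc (suc s)) with even? s | even?-sound s
  ... | true  | even = even-+2 even
  ... | false | odd  = λ { (divides zero ()) ; (divides (suc q) eq) → odd (divides q (ℕ.suc-injective (ℕ.suc-injective eq))) }

  AltDescentAtStart : Bool → Fin m → Vec (Fin m) k → Set
  AltDescentAtStart o x []      = ⊤
  AltDescentAtStart o x (y ∷ _) = T (altDescent o x y)

  Suffix : Bool → ℕ → Fin m → Vec (Fin m) k → Set
  Suffix z s x v = (T z → AltDescentAtStart (even? s) x v) × Admissible s (x ∷ v)

  -- If s is even, the step goes down to `y`, which can only be a valley, and its position 2 + s is
  -- even. If s is odd, it goes up and `y` can only be a peak at an odd position.
  altDescent⇒start : ∀ s (x y : Fin m) (v : Vec (Fin m) k) →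
                     T (altDescent (even? s) x y) → AdmissibleStart s x y v
  altDescent⇒start s x y [] _ = tt
  altDescent⇒start s x y (z ∷ v) d with even? s | even?-sound s
  ... | true  | even = (λ _ _ → even) , λ x<y → contradiction x<y (ℕ.<-asym (ℕ.<ᵇ⇒< (toℕ y) (toℕ x) d))
  ... | false | odd  = (λ y<x → contradiction y<x (ℕ.<-asym (ℕ.<ᵇ⇒< (toℕ x) (toℕ y) d))) , λ _ _ → odd

  -- Alternating descents at consecutive positions have opposite directions. If the first step fails
  -- and the second does not, both steps go the same way, and `y` is neither a peak nor a valley.
  altDescents⇒start : ∀ s (x y : Fin m) (v : Vec (Fin m) k) → ¬ T (altDescent (even? s) x y) →
                      AltDescentAtStart (even? (suc s)) y v → AdmissibleStart s x y v
  altDescents⇒start s x y []      _  _ = tt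
  altDescents⇒start s x y (z ∷ v) ¬d d with even? s
  ... | true  = (λ y<x → contradiction (ℕ.<⇒<ᵇ y<x) ¬d) ,
                λ _ z<y → contradiction z<y (ℕ.<-asym (ℕ.<ᵇ⇒< (toℕ y) (toℕ z) d))
  ... | false = (λ _ y<z → contradiction y<z (ℕ.<-asym (ℕ.<ᵇ⇒< (toℕ z) (toℕ y) d))) ,
                λ x<y → contradiction (ℕ.<⇒<ᵇ x<y) ¬d

  ≮⇒> : ∀ {x y : Fin m} → x ≢ y → ¬ (y Fin.< x) → x Fin.< y
  ≮⇒> x≢y y≮x = ℕ.≤∧≢⇒< (ℕ.≮⇒≥ y≮x) (x≢y ∘ Fin.toℕ-injective)

  -- Two consecutive failures would make `y` a peak at an even position or a valley at an odd one.
  -- Distinctness is what turns a failed descent into an ascent and conversely.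
  start⇒altDescent : ∀ s {x y : Fin m} {v : Vec (Fin m) k} → Unique (x ∷ y ∷ v) → AdmissibleStart s x y v →
                     ¬ T (altDescent (even? s) x y) → AltDescentAtStart (even? (suc s)) y v
  start⇒altDescent s {v = []} _ _ _ = tt
  start⇒altDescent s {v = z ∷ v} ((x≢y ∷ _) ∷ (y≢z ∷ _) ∷ _) (valley , peak) ¬d with even? s | even?-sound s
  ... | true  | even = ℕ.<⇒<ᵇ (≮⇒> y≢z λ z<y → peak (≮⇒> x≢y (¬d ∘ ℕ.<⇒<ᵇ)) z<y even)
  ... | false | odd  = ℕ.<⇒<ᵇ (≮⇒> (y≢z ∘ sym) λ y<z → odd (valley (≮⇒> (x≢y ∘ sym) (¬d ∘ ℕ.<⇒<ᵇ)) y<z))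

  weight-indicates : ∀ z s (x : Fin m) (v : Vec (Fin m) k) → Unique (x ∷ v) →
                     Indicates (Suffix z s x v) (weight (even? s) z x v)
  weight-indicates z s x []      _ = holds ((λ _ → tt) , admissible-singleton s x)
  weight-indicates z s x (y ∷ v) uniq@(_ ∷ uniq′)
    -- The three lemmas are abstracted along with the Boolean, so that their hypotheses about it
    -- compute in each case.
    with altDescent (even? s) x y | altDescent⇒start s x y v | altDescents⇒start s x y v | start⇒altDescent s uniq
  weight-indicates z s x (y ∷ v) (_ ∷ uniq′) | true | start | _ | _ = indicates-⇔
    (λ (_ , adm) → (λ _ → tt) , admissible-cons s x y v (start tt) adm)
    (λ (_ , adm) → (λ ()) , admissible-tail s x (y ∷ v) adm)
    (weight-indicates false (suc s) y v uniq′)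
  weight-indicates true s x (y ∷ v) _ | false | _ | _ | _ = fails λ (d , _) → d tt
  weight-indicates false s x (y ∷ v) (_ ∷ uniq′) | false | _ | start | descends = indicates-⇔
    (λ (d , adm) → (λ ()) , admissible-cons s x y v (start id (d tt)) adm)
    (λ (_ , adm) → (λ _ → descends (admissible-start s x y v adm) id) , admissible-tail s x (y ∷ v) adm)
    (weight-indicates true (suc s) y v uniq′)

  counted-weight : (x : Fin (suc n)) (v : Vec (Fin (suc n)) n) →
                   ⟦ counted? (x ∷ v) ⟧ ≡ unique (x ∷ v) * weight true false x v
  counted-weight x v = indicates-unique
    (λ (uniq , adm) → uniq , (λ ()) , adm)
    (λ (uniq , _ , adm) → uniq , adm)
    (⟦⟧-indicates (counted? (x ∷ v)))
    (indicates-× (unique-indicates (x ∷ v)) (weight-indicates false 0 x v))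

  -- Totals over the first letter, and reversal of the alphabet.

  rowSum : Bool → ℕ → ℕ
  rowSum o n = sum λ (j : Fin (suc n)) → E o false n (toℕ j)

  f-suc : ∀ n → f (suc n) ≡ rowSum true n
  f-suc n = begin
    f (suc n)                                     ≡⟨ length-filter-words {suc n} {suc n} counted? ⟩
    W (suc n) (suc n) (⟦_⟧ ∘ counted?)
        ≡⟨ sum-cong-≗ (λ x → trans (W-cong n (counted-weight x)) (count≡E true false n x)) ⟩
    rowSum true n                                 ∎

  <ᵇ-true : ∀ {i j} → i < j → (i <ᵇ j) ≡ true
  <ᵇ-true i<j = Equivalence.to T-≡ (ℕ.<⇒<ᵇ i<j)

  <ᵇ-false : ∀ {i j} → j ≤ i → (i <ᵇ j) ≡ false
  <ᵇ-false {i} {j} j≤i = ¬-not λ eq → ℕ.≤⇒≯ j≤i (ℕ.<ᵇ⇒< i j (Equivalence.from T-≡ eq))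

  -- The two alphabets differ in size by one, so the reversed comparison is weak: n - 1 - j < n - k
  -- exactly when k ≤ j.
  opposite-<ᵇ : (j : Fin n) (k : Fin (suc n)) →
                (toℕ (opposite j) <ᵇ toℕ (opposite k)) ≡ not (toℕ j <ᵇ toℕ k)
  opposite-<ᵇ {n} j k rewrite Fin.opposite-prop j | Fin.opposite-prop k with toℕ j ℕ.<? toℕ k
  ... | yes j<k rewrite <ᵇ-true j<k = <ᵇ-false (ℕ.∸-monoʳ-≤ n j<k)
  ... | no  j≮k rewrite <ᵇ-false (ℕ.≮⇒≥ j≮k) =
    <ᵇ-true (ℕ.∸-monoʳ-< (s≤s (ℕ.≮⇒≥ j≮k)) (Fin.toℕ<n j))

  split-opposite : ∀ a a′ b b′ (k : Fin (suc n)) →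
    (∀ (j : Fin n) → a (toℕ j) ≡ a′ (toℕ (opposite j))) →
    (∀ (j : Fin n) → b (toℕ j) ≡ b′ (toℕ (opposite j))) →
    split n (toℕ k) a b ≡ split n (toℕ (opposite k)) b′ a′
  split-opposite {n} a a′ b b′ k a≡a′ b≡b′ = begin
    split n (toℕ k) a b
      ≡⟨ sum-cong-≗ {n} (λ j → trans (cong₂ (if toℕ j <ᵇ toℕ k then_else_) (a≡a′ j) (b≡b′ j))
          (trans (sym (if-not (toℕ j <ᵇ toℕ k))) (cong (if_then b′ (toℕ (opposite j)) else a′ (toℕ (opposite j)))
              (sym (opposite-<ᵇ j k))))) ⟩
    (sum λ (j : Fin n) → if toℕ (opposite j) <ᵇ toℕ (opposite k) then b′ (toℕ (opposite j)) else a′ (toℕ (opposite j)))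
      ≡⟨ sum-permute {n} {n} (λ j → if toℕ j <ᵇ toℕ (opposite k) then b′ (toℕ j) else a′ (toℕ j)) reverse ⟨
    split n (toℕ (opposite k)) b′ a′ ∎

  -- Replacing every letter by its opposite exchanges ascents and descents, and therefore odd and
  -- even starting positions.
  E-opposite : ∀ z n (k : Fin (suc n)) → E true z n (toℕ k) ≡ E false z n (toℕ (opposite k))
  E-opposite z zero    k = refl
  E-opposite z (suc n) k = split-opposite
    (E false false n) (E true false n) (unless z (E false true n)) (unless z (E true true n)) k
    (λ j → trans (cong (E false false n) (cong toℕ (sym (Fin.opposite-involutive j)))) (sym (E-opposite false n (opposite j))))
    (λ j → unless-opposite z j)
    where
    unless-opposite : ∀ z (j : Fin (suc n)) → unless z (E false true n) (toℕ j) ≡ unless z (E true true n) (toℕ (opposite j))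
    unless-opposite true  j = refl
    unless-opposite false j =
      trans (cong (E false true n) (cong toℕ (sym (Fin.opposite-involutive j)))) (sym (E-opposite true n (opposite j)))

  rowSum-flip : ∀ n → rowSum false n ≡ rowSum true n
  rowSum-flip n = begin
    rowSum false n ≡⟨ sum-permute {suc n} {suc n} (λ j → E false false n (toℕ j)) reverse ⟩
    _              ≡⟨ sum-cong-≗ (E-opposite false n) ⟨
    rowSum true n  ∎

  -- Neighbouring first letters, and extreme ones.

  split-suc : ∀ {N k} a b → k < N → split N (suc k) a b + b k ≡ split N k a b + a k
  split-suc {suc N} {zero} a b _ = begin
    a 0 + rest + b 0   ≡⟨ ℕ.+-comm (a 0 + rest) (b 0) ⟩
    b 0 + (a 0 + rest) ≡⟨ cong (b 0 +_) (ℕ.+-comm (a 0) rest) ⟩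
    b 0 + (rest + a 0) ≡⟨ ℕ.+-assoc (b 0) rest (a 0) ⟨
    b 0 + rest + a 0   ∎
    where rest = split N 0 (a ∘ suc) (b ∘ suc)
  split-suc {suc N} {suc k} a b (s≤s k<N) = begin
    a 0 + split N (suc k) (a ∘ suc) (b ∘ suc) + b (suc k)   ≡⟨ ℕ.+-assoc (a 0) _ _ ⟩
    a 0 + (split N (suc k) (a ∘ suc) (b ∘ suc) + b (suc k)) ≡⟨ cong (a 0 +_) (split-suc (a ∘ suc) (b ∘ suc) k<N) ⟩
    a 0 + (split N k (a ∘ suc) (b ∘ suc) + a (suc k))       ≡⟨ ℕ.+-assoc (a 0) _ _ ⟨
    a 0 + split N k (a ∘ suc) (b ∘ suc) + a (suc k)         ∎

  split-all : ∀ N a b → split N N a b ≡ sum (a ∘ toℕ {N})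
  split-all N a b = sum-cong-≗ {N} λ j → cong (if_then a (toℕ j) else b (toℕ j)) (<ᵇ-true (Fin.toℕ<n j))

  -- i and j are the numbers of letters smaller and larger than the first one.
  entry : Bool → Bool → ℕ → ℕ → ℕ
  entry o z i j = E o z (i + j) i

  -- Moving the threshold of `split` past i changes only the summand at i. Free of subtraction, this
  -- is the coefficient form of δU = Ū - Z̄ for `z` false and of δZ = Ū for `z` true.
  entry-true : ∀ z i j → entry true z (suc i) j + unless z (entry false true i) j ≡
                         entry true z i (suc j) + entry false false i j
  entry-true z i j rewrite ℕ.+-suc i j with z
  ... | true  = split-suc (E false false (i + j)) (λ _ → 0) (s≤s (ℕ.m≤m+n i j))
  ... | false = split-suc (E false false (i + j)) (E false true (i + j)) (s≤s (ℕ.m≤m+n i j))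

  entry-false : ∀ z i j → entry false z (suc i) j + entry true false i j ≡
                          entry false z i (suc j) + unless z (entry true true i) j
  entry-false z i j rewrite ℕ.+-suc i j with z
  ... | true  = split-suc (λ _ → 0) (E true false (i + j)) (s≤s (ℕ.m≤m+n i j))
  ... | false = split-suc (E true true (i + j)) (E true false (i + j)) (s≤s (ℕ.m≤m+n i j))

  -- From the largest letter the first step is a descent, so forcing it changes nothing. What
  -- remains is a free word with even start, and reversal relates it to odd start.
  entry-true-max : ∀ z n → entry true z n 0 ≡ f n
  entry-true-max z zero = refl
  entry-true-max z (suc n) rewrite ℕ.+-identityʳ n = begin
    split (suc n) (suc n) (E false false n) (unless z (E false true n)) ≡⟨ split-all (suc n) (E false false n)
        (unless z (E false true n)) ⟩
    rowSum false n                            ≡⟨ rowSum-flip n ⟩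
    rowSum true n                             ≡⟨ f-suc n ⟨
    f (suc n)                                 ∎

  -- From the smallest letter the forced ascent is automatic, and the remaining word is free with
  -- odd start.
  entry-false-min : ∀ n → entry false true 0 n ≡ f n
  entry-false-min zero    = refl
  entry-false-min (suc n) = sym (f-suc n)

  -- The smallest letter cannot begin a descent.
  entry-true-min : ∀ n → entry true true 0 (suc n) ≡ 0
  entry-true-min n = sum-replicate-zero (suc n)

  entry-false-max : ∀ n → entry false true (suc n) 0 ≡ 0
  entry-false-max n rewrite ℕ.+-identityʳ n =
    trans (split-all (suc n) (λ _ → 0) (E true false n)) (sum-replicate-zero (suc n))

open Enumeration using (entry; entry-true; entry-false; entry-true-max; entry-false-min; entry-true-min; entry-false-max)
open import Data.Integer.Base using (+_)

-- Rational numbers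

open Algebra.Properties.Group ℚ.+-0-group using (⁻¹-involutive)

-- Passing to unnormalised fractions avoids the gcd in `_/_` and reduces identities to
-- cross-multiplication.
toℚᵘ-/ : ∀ z d .{{_ : ℕ.NonZero d}} → toℚᵘ (z / d) ℚᵘ.≃ z ℚᵘ./ d
toℚᵘ-/ z (suc d) = ℚ.toℚᵘ-fromℚᵘ (mkℚᵘ z d)

/-≡-*-/ : ∀ z d .{{_ : ℕ.NonZero d}} → z / d ≡ (z / 1) ℚ.* (+ 1 / d)
/-≡-*-/ z d@(suc _) = ℚ.toℚᵘ-injective (begin
  toℚᵘ (z / d)                          ≈⟨ toℚᵘ-/ z d ⟩
  z ℚᵘ./ d                              ≈⟨ *≡* (≡.cong₂ ℤ._*_ (≡.sym (ℤ.*-identityʳ z)) (ℤ.*-identityˡ (+ d))) ⟩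
  (z ℚᵘ./ 1) ℚᵘ.* (+ 1 ℚᵘ./ d)          ≈⟨ ℚᵘ.*-cong (toℚᵘ-/ z 1) (toℚᵘ-/ (+ 1) d) ⟨
  toℚᵘ (z / 1) ℚᵘ.* toℚᵘ (+ 1 / d)      ≈⟨ ℚ.toℚᵘ-homo-* (z / 1) (+ 1 / d) ⟨
  toℚᵘ ((z / 1) ℚ.* (+ 1 / d))          ∎)
  where open import Relation.Binary.Reasoning.Setoid ℚᵘ.≃-setoid

suc/1 : ∀ n → + suc n / 1 ≡ 1ℚ ℚ.+ (+ n / 1)
suc/1 n = ℚ.toℚᵘ-injective (begin
  toℚᵘ (+ suc n / 1)                    ≈⟨ toℚᵘ-/ (+ suc n) 1 ⟩
  + suc n ℚᵘ./ 1                        ≈⟨ *≡* (≡.cong (λ k → (+ 1 ℤ.+ k) ℤ.* + 1) (≡.sym (ℤ.*-identityʳ (+ n)))) ⟩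
  (+ 1 ℚᵘ./ 1) ℚᵘ.+ (+ n ℚᵘ./ 1)        ≈⟨ ℚᵘ.+-cong (toℚᵘ-/ (+ 1) 1) (toℚᵘ-/ (+ n) 1) ⟨
  toℚᵘ 1ℚ ℚᵘ.+ toℚᵘ (+ n / 1)           ≈⟨ ℚ.toℚᵘ-homo-+ 1ℚ (+ n / 1) ⟨
  toℚᵘ (1ℚ ℚ.+ (+ n / 1))               ∎)
  where open import Relation.Binary.Reasoning.Setoid ℚᵘ.≃-setoid

suc*1/suc! : ∀ n → (+ suc n / 1) ℚ.* (_/_ (+ 1) (suc n !) {{suc n !≢0}}) ≡ _/_ (+ 1) (n !) {{n !≢0}}
-- The factorial is generalised together with its nonzero proofs so that it can be matched as a
-- successor.
suc*1/suc! n with n ! | n !≢0 | suc n !≢0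
... | d@(suc _) | _ | _ = ℚ.toℚᵘ-injective (begin
  toℚᵘ ((+ suc n / 1) ℚ.* (+ 1 / (suc n ℕ.* d)))        ≈⟨ ℚ.toℚᵘ-homo-* (+ suc n / 1) (+ 1 / (suc n ℕ.* d)) ⟩
  toℚᵘ (+ suc n / 1) ℚᵘ.* toℚᵘ (+ 1 / (suc n ℕ.* d))    ≈⟨ ℚᵘ.*-cong (toℚᵘ-/ (+ suc n) 1) (toℚᵘ-/ (+ 1) (suc n ℕ.* d)) ⟩
  (+ suc n ℚᵘ./ 1) ℚᵘ.* (+ 1 ℚᵘ./ (suc n ℕ.* d))        ≈⟨ *≡* (≡.cong +_ lemma) ⟩
  + 1 ℚᵘ./ d                                            ≈⟨ toℚᵘ-/ (+ 1) d ⟨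
  toℚᵘ (+ 1 / d)                                        ∎)
  where
  open import Relation.Binary.Reasoning.Setoid ℚᵘ.≃-setoid
  lemma : (suc n ℕ.* 1) ℕ.* d ≡ 1 ℕ.* (1 ℕ.* (suc n ℕ.* d))
  lemma = ≡.trans (≡.cong (ℕ._* d) (ℕ.*-identityʳ (suc n)))
    (≡.sym (≡.trans (ℕ.*-identityˡ _) (ℕ.*-identityˡ _)))

neg-/ : ∀ z d .{{_ : ℕ.NonZero d}} → (ℤ.- z) / d ≡ ℚ.- (z / d)
neg-/ (+ zero)   d = ≡.trans (ℚ.0/n≡0 d) (≡.cong ℚ.-_ (≡.sym (ℚ.0/n≡0 d)))
neg-/ (+ suc n)  d = ≡.refl
neg-/ (-[1+ n ]) d = ≡.sym (⁻¹-involutive (+ suc n / d))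

recurrence-unique : ∀ {A : Set} (g : A → A) (a b : ℕ → A) →
                    (∀ n → a (2 ℕ.+ n) ≡ g (a n)) → (∀ n → b (2 ℕ.+ n) ≡ g (b n)) →
                    a 0 ≡ b 0 → a 1 ≡ b 1 → ∀ n → a n ≡ b n
recurrence-unique g a b p q r₀ r₁ zero          = r₀
recurrence-unique g a b p q r₀ r₁ (suc zero)    = r₁
recurrence-unique g a b p q r₀ r₁ (suc (suc n)) =
  ≡.trans (p n) (≡.trans (≡.cong g (recurrence-unique g a b p q r₀ r₁ n)) (≡.sym (q n)))

module Analysis {c ℓ : Level} (R : CommutativeRing c ℓ)
                (ι : ℚ → CommutativeRing.Carrier R)
                (ι-hom : RingMorphisms.IsRingHomomorphism +-*-rawRing (CommutativeRing.rawRing R) ι)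
                where

  open CommutativeRing R
  open Algebra.Properties.Semiring.Exp semiring using (_^_)
  open PowerSeries R
  open RingMorphisms.IsRingHomomorphism ι-hom
    using () renaming (+-homo to ι-+; *-homo to ι-*; -‿homo to ι-neg; 0#-homo to ι-0; 1#-homo to ι-1)
  open import Relation.Binary.Reasoning.Setoid setoid

  -- ι, made to compute to 0# and 1# so that the solver's constants are definitionally those of R.
  ρ : ℚ → Carrier
  ρ q with q ℚ.≟ 0ℚ | q ℚ.≟ 1ℚ
  ... | yes _ | _     = 0#
  ... | no _  | yes _ = 1#
  ... | no _  | no _  = ι q

  ρ≈ι : ∀ q → ρ q ≈ ι q
  ρ≈ι q with q ℚ.≟ 0ℚ | q ℚ.≟ 1ℚ
  ... | yes ≡.refl | _          = sym ι-0
  ... | no _       | yes ≡.refl = sym ι-1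
  ... | no _       | no _       = refl

  ρ-morphism : +-*-rawRing -Raw-AlmostCommutative⟶ fromCommutativeRing R
  ρ-morphism = record
    { ⟦_⟧    = ρ
    ; +-homo = λ p q → trans (ρ≈ι (p ℚ.+ q)) (trans (ι-+ p q) (sym (+-cong (ρ≈ι p) (ρ≈ι q))))
    ; *-homo = λ p q → trans (ρ≈ι (p ℚ.* q)) (trans (ι-* p q) (sym (*-cong (ρ≈ι p) (ρ≈ι q))))
    ; -‿homo = λ p → trans (ρ≈ι (ℚ.- p)) (trans (ι-neg p) (sym (-‿cong (ρ≈ι p))))
    ; 0-homo = refl
    ; 1-homo = refl
    }

  ρ-≟ : ∀ p q → Maybe (ρ p ≈ ρ q)
  ρ-≟ p q with p ℚ.≟ q
  ... | yes ≡.refl = just refl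
  ... | no _       = nothing

  open Algebra.Solver.Ring +-*-rawRing (fromCommutativeRing R) ρ-morphism ρ-≟
    using (solve; _:=_; con; _:+_; _:*_; _:-_; :-_)

  -- Cauchy products

  private variable
    a b a′ : Series

  ⊛-congʳ : ∀ b → a ≋ a′ → a ⊛ b ≋ a′ ⊛ b
  ⊛-congʳ b p zero    = +-congʳ (*-congʳ (p 0))
  ⊛-congʳ b p (suc n) = +-cong (*-congʳ (p 0)) (⊛-congʳ b (p ∘ suc) n)

  -- The Cauchy sum computes by splitting off its first term; this splits off the last one.
  ⊛-suc : ∀ a b n → (a ⊛ b) (suc n) ≈ (a ⊛ (b ∘ suc)) n + a (suc n) * b 0
  ⊛-suc a b zero    = solve 4 (λ a₀ a₁ b₀ b₁ → a₀ :* b₁ :+ (a₁ :* b₀ :+ con 0ℚ) := a₀ :* b₁ :+ con 0ℚ :+ a₁ :* b₀)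
    refl (a 0) (a 1) (b 0) (b 1)
  ⊛-suc a b (suc n) = trans (+-congˡ (⊛-suc (a ∘ suc) b n)) (sym (+-assoc _ _ _))

  ⊛-comm : ∀ a b → a ⊛ b ≋ b ⊛ a
  ⊛-comm a b zero    = +-congʳ (*-comm (a 0) (b 0))
  ⊛-comm a b (suc n) = begin
    a 0 * b (suc n) + ((a ∘ suc) ⊛ b) n ≈⟨ +-cong (*-comm (a 0) (b (suc n))) (⊛-comm (a ∘ suc) b n) ⟩
    b (suc n) * a 0 + (b ⊛ (a ∘ suc)) n ≈⟨ +-comm _ _ ⟩
    (b ⊛ (a ∘ suc)) n + b (suc n) * a 0 ≈⟨ ⊛-suc b a n ⟨
    (b ⊛ a) (suc n)                     ∎

  ⊛-linearˡ : ∀ {a a₁ a₂} x y → (∀ n → a n ≈ x * a₁ n + y * a₂ n) →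
              ∀ b n → (a ⊛ b) n ≈ x * (a₁ ⊛ b) n + y * (a₂ ⊛ b) n
  ⊛-linearˡ {a} {a₁} {a₂} x y eq b zero = trans (+-congʳ (*-congʳ (eq 0)))
    (solve 5 (λ x y a₁ a₂ b → (x :* a₁ :+ y :* a₂) :* b :+ con 0ℚ := x :* (a₁ :* b :+ con 0ℚ) :+ y :* (a₂ :* b :+ con 0ℚ))
      refl x y (a₁ 0) (a₂ 0) (b 0))
  ⊛-linearˡ {a} {a₁} {a₂} x y eq b (suc n) = trans (+-cong (*-congʳ (eq 0)) (⊛-linearˡ x y (eq ∘ suc) b n))
    (solve 7 (λ x y a₁ a₂ b s₁ s₂ → (x :* a₁ :+ y :* a₂) :* b :+ (x :* s₁ :+ y :* s₂) := x :* (a₁ :* b :+ s₁) :+ y :*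
        (a₂ :* b :+ s₂))
      refl x y (a₁ 0) (a₂ 0) (b (suc n)) (((a₁ ∘ suc) ⊛ b) n) (((a₂ ∘ suc) ⊛ b) n))

  ⊛-linearʳ : ∀ {b b₁ b₂} x y → (∀ n → b n ≈ x * b₁ n + y * b₂ n) →
              ∀ a n → (a ⊛ b) n ≈ x * (a ⊛ b₁) n + y * (a ⊛ b₂) n
  ⊛-linearʳ {b} {b₁} {b₂} x y eq a n = begin
    (a ⊛ b) n                           ≈⟨ ⊛-comm a b n ⟩
    (b ⊛ a) n                           ≈⟨ ⊛-linearˡ x y eq a n ⟩
    x * (b₁ ⊛ a) n + y * (b₂ ⊛ a) n     ≈⟨ +-cong (*-congˡ (⊛-comm b₁ a n)) (*-congˡ (⊛-comm b₂ a n)) ⟩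
    x * (a ⊛ b₁) n + y * (a ⊛ b₂) n     ∎

  ⊛-assoc : ∀ a b d → (a ⊛ b) ⊛ d ≋ a ⊛ (b ⊛ d)
  ⊛-assoc a b d zero = solve 3 (λ a b d → (a :* b :+ con 0ℚ) :* d :+ con 0ℚ := a :* (b :* d :+ con 0ℚ) :+ con 0ℚ)
    refl (a 0) (b 0) (d 0)
  ⊛-assoc a b d (suc n) = begin
    (a 0 * b 0 + 0#) * d (suc n) + (((a ⊛ b) ∘ suc) ⊛ d) n
      -- The tail of `a ⊛ b` is `a 0` times the tail of `b`, plus the tail of `a` times `b`.
      ≈⟨ +-congˡ (⊛-linearˡ {a₁ = b ∘ suc} {(a ∘ suc) ⊛ b} (a 0) 1# (λ n → +-congˡ (sym (*-identityˡ _))) d n) ⟩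
    (a 0 * b 0 + 0#) * d (suc n) + (a 0 * ((b ∘ suc) ⊛ d) n + 1# * (((a ∘ suc) ⊛ b) ⊛ d) n)
      ≈⟨ +-congˡ (+-congˡ (*-congˡ (⊛-assoc (a ∘ suc) b d n))) ⟩
    (a 0 * b 0 + 0#) * d (suc n) + (a 0 * ((b ∘ suc) ⊛ d) n + 1# * ((a ∘ suc) ⊛ (b ⊛ d)) n)
      ≈⟨ solve 5 (λ a b d s t → (a :* b :+ con 0ℚ) :* d :+ (a :* s :+ con 1ℚ :* t) := a :* (b :* d :+ s) :+ t)
           refl (a 0) (b 0) (d (suc n)) (((b ∘ suc) ⊛ d) n) (((a ∘ suc) ⊛ (b ⊛ d)) n) ⟩
    (a ⊛ (b ⊛ d)) (suc n) ∎

  0ˢ : Series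
  0ˢ _ = 0#

  ⊛-zeroˡ : ∀ a → 0ˢ ⊛ a ≋ 0ˢ
  ⊛-zeroˡ a zero    = trans (+-identityʳ _) (zeroˡ _)
  ⊛-zeroˡ a (suc n) = trans (+-cong (zeroˡ _) (⊛-zeroˡ a n)) (+-identityʳ _)

  ⊛-identityˡ : ∀ a → 1ˢ ⊛ a ≋ a
  ⊛-identityˡ a zero    = trans (+-identityʳ _) (*-identityˡ _)
  ⊛-identityˡ a (suc n) = trans (+-cong (*-identityˡ _) (⊛-zeroˡ a n)) (+-identityʳ _)

  -- Long division of series by d, where e is the inverse of the constant term of d.

  module Division (d : Series) (e : Carrier) (e*d₀≈1 : e * d 0 ≈ 1#) where

    remainder : Series → Series
    remainder a n = a (suc n) - e * a 0 * d (suc n)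

    quotient : Series → Series
    quotient a zero    = e * a 0
    quotient a (suc n) = quotient (remainder a) n

    quotient-⊛ : ∀ a → quotient a ⊛ d ≋ a
    quotient-⊛ a zero = begin
      e * a 0 * d 0 + 0#  ≈⟨ solve 3 (λ e a d → e :* a :* d :+ con 0ℚ := e :* d :* a) refl e (a 0) (d 0) ⟩
      e * d 0 * a 0       ≈⟨ *-congʳ e*d₀≈1 ⟩
      1# * a 0            ≈⟨ *-identityˡ _ ⟩
      a 0                 ∎
    quotient-⊛ a (suc n) = begin
      e * a 0 * d (suc n) + (quotient (remainder a) ⊛ d) n        ≈⟨ +-congˡ (quotient-⊛ (remainder a) n) ⟩
      e * a 0 * d (suc n) + (a (suc n) - e * a 0 * d (suc n))     ≈⟨ solve 2 (λ p a → p :+ (a :- p) := a) refl _ _ ⟩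
      a (suc n)                                                   ∎

    invertible : Invertible _≋_ 1ˢ _⊛_ d
    invertible = quotient 1ˢ , quotient-⊛ 1ˢ ,
      λ n → trans (⊛-comm d (quotient 1ˢ) n) (quotient-⊛ 1ˢ n)

    ⊛⇒÷ : a ⊛ d ≋ b → a ≋ b ÷ d
    ⊛⇒÷ {a} {b} a⊛d≋b = invertible , λ n → begin
      a n                          ≈⟨ ⊛-identityˡ a n ⟨
      (1ˢ ⊛ a) n                   ≈⟨ ⊛-congʳ a (quotient-⊛ 1ˢ) n ⟨
      ((quotient 1ˢ ⊛ d) ⊛ a) n    ≈⟨ ⊛-assoc (quotient 1ˢ) d a n ⟩
      (quotient 1ˢ ⊛ (d ⊛ a)) n    ≈⟨ ⊛-comm (quotient 1ˢ) (d ⊛ a) n ⟩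
      ((d ⊛ a) ⊛ quotient 1ˢ) n    ≈⟨ ⊛-congʳ (quotient 1ˢ) (λ m → trans (⊛-comm d a m) (a⊛d≋b m)) n ⟩
      (b ⊛ quotient 1ˢ) n          ∎

  -- Derivatives

  ν : ℕ → Carrier
  ν zero    = 0#
  ν (suc n) = 1# + ν n

  ν-+ : ∀ m n → ν (m ℕ.+ n) ≈ ν m + ν n
  ν-+ zero    n = sym (+-identityˡ _)
  ν-+ (suc m) n = trans (+-congˡ (ν-+ m n)) (sym (+-assoc _ _ _))

  ν≈ι : ∀ n → ν n ≈ ι (+ n / 1)
  ν≈ι zero    = sym ι-0
  ν≈ι (suc n) = sym (begin
    ι (+ suc n / 1)         ≡⟨ ≡.cong ι (suc/1 n) ⟩
    ι (1ℚ ℚ.+ (+ n / 1))    ≈⟨ ι-+ 1ℚ (+ n / 1) ⟩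
    ι 1ℚ + ι (+ n / 1)      ≈⟨ +-cong ι-1 (sym (ν≈ι n)) ⟩
    1# + ν n                ∎)

  -- `θ` is the Euler operator x d/dx. It preserves degrees, so its product rule follows by
  -- induction on them; the rule for `∂` is the same identity one degree higher.
  θ ∂ : Series → Series
  θ a n = ν n * a n
  ∂ a n = ν (suc n) * a (suc n)

  θ-⊛ : ∀ a b n → ν n * (a ⊛ b) n ≈ (θ a ⊛ b) n + (a ⊛ θ b) n
  θ-⊛ a b zero = solve 2 (λ a b → con 0ℚ :* (a :* b :+ con 0ℚ) :=
    con 0ℚ :* a :* b :+ con 0ℚ :+ (a :* (con 0ℚ :* b) :+ con 0ℚ)) refl (a 0) (b 0)
  θ-⊛ a b (suc n) = begin
    (1# + ν n) * (a 0 * b (suc n) + s)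
      ≈⟨ solve 4 (λ ν a b s → (con 1ℚ :+ ν) :* (a :* b :+ s) := a :* ((con 1ℚ :+ ν) :* b) :+ s :+ ν :* s) refl (ν n) (a 0)
          (b (suc n)) s ⟩
    a 0 * ((1# + ν n) * b (suc n)) + s + ν n * s
      ≈⟨ +-congˡ (θ-⊛ (a ∘ suc) b n) ⟩
    a 0 * ((1# + ν n) * b (suc n)) + s + ((θ (a ∘ suc) ⊛ b) n + ((a ∘ suc) ⊛ θ b) n)
      ≈⟨ solve 6 (λ x s t u a b → x :+ s :+ (t :+ u) := con 0ℚ :* a :* b :+ (con 1ℚ :* t :+ con 1ℚ :* s) :+ (x :+ u)) refl
           (a 0 * ((1# + ν n) * b (suc n))) s ((θ (a ∘ suc) ⊛ b) n) (((a ∘ suc) ⊛ θ b) n) (a 0) (b (suc n)) ⟩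
    0# * a 0 * b (suc n) + (1# * (θ (a ∘ suc) ⊛ b) n + 1# * s) + (a ⊛ θ b) (suc n)
      -- The tail of `θ a` is `θ` of the tail of `a` plus that tail itself.
      ≈⟨ +-congʳ (+-congˡ (⊛-linearˡ 1# 1# (λ m → solve 2 (λ ν a → (con 1ℚ :+ ν) :* a := con 1ℚ :* (ν :* a) :+ con 1ℚ :* a)
          refl (ν m) (a (suc m))) b n)) ⟨
    (θ a ⊛ b) (suc n) + (a ⊛ θ b) (suc n) ∎
    where s = ((a ∘ suc) ⊛ b) n

  ∂-⊛ : ∀ a b n → ∂ (a ⊛ b) n ≈ (∂ a ⊛ b) n + (a ⊛ ∂ b) n
  ∂-⊛ a b n = begin
    ν (suc n) * (a ⊛ b) (suc n)                ≈⟨ θ-⊛ a b (suc n) ⟩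
    0# * a 0 * b (suc n) + (∂ a ⊛ b) n + (a ⊛ θ b) (suc n)
      ≈⟨ +-congˡ (⊛-suc a (θ b) n) ⟩
    0# * a 0 * b (suc n) + (∂ a ⊛ b) n + ((a ⊛ ∂ b) n + a (suc n) * (0# * b 0))
      ≈⟨ solve 6 (λ a b a′ b′ s t → con 0ℚ :* a :* b :+ s :+ (t :+ a′ :* (con 0ℚ :* b′)) := s :+ t) refl
          (a 0) (b (suc n)) (a (suc n)) (b 0) ((∂ a ⊛ b) n) ((a ⊛ ∂ b) n) ⟩
    (∂ a ⊛ b) n + (a ⊛ ∂ b) n ∎

  -- Two-variable series

  Series₂ : Set c
  Series₂ = ℕ → ℕ → Carrier

  δ : Series₂ → Series₂
  δ A i j = ν (suc i) * A (suc i) j - ν (suc j) * A i (suc j)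

  -- The product A(x,y) X(x) Y(y).
  twist : Series₂ → Series → Series → Series₂
  twist A X Y i j = ((λ i → (A i ⊛ Y) j) ⊛ X) i

  -- This is the product rule for ∂/∂x - ∂/∂y: the factor in x contributes its derivative, the
  -- factor in y minus its derivative.
  δ-twist : ∀ {A B C X X′ Y Y′} β γ ξ η →
            (∀ i j → δ A i j ≈ β * B i j + γ * C i j) →
            (∀ n → ∂ X n ≈ ξ * X′ n) → (∀ n → ∂ Y n ≈ η * Y′ n) →
            ∀ i j → δ (twist A X Y) i j ≈
                    β * twist B X Y i j + γ * twist C X Y i j + ξ * twist A X′ Y i j - η * twist A X Y′ i j
  δ-twist {A} {B} {C} {X} {X′} {Y} {Y′} β γ ξ η δA ∂X ∂Y i j = begin
    ∂ (column j A ⊛ X) i - q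
      ≈⟨ +-congʳ (∂-⊛ (column j A) X i) ⟩
    (∂ (column j A) ⊛ X) i + (column j A ⊛ ∂ X) i - q
      ≈⟨ +-congʳ (+-cong
           (⊛-linearˡ {a₁ = column (suc j) A} {λ i → G i} (ν (suc j)) 1# ∂-column X i)
           (⊛-linearʳ {b₁ = X′} {X′} ξ 0# (λ n → trans (∂X n) (solve 2 (λ ξ x → ξ :* x := ξ :* x :+ con 0ℚ :* x) refl ξ
               (X′ n))) (column j A) i)) ⟩
    q + 1# * (G ⊛ X) i + (ξ * t₃ + 0# * t₃) - q
      ≈⟨ solve 4 (λ q g ξ t → q :+ con 1ℚ :* g :+ (ξ :* t :+ con 0ℚ :* t) :- q := g :+ ξ :* t) refl q ((G ⊛ X) i) ξ t₃ ⟩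
    (G ⊛ X) i + ξ * t₃
      ≈⟨ +-congʳ (trans (⊛-linearˡ {a₁ = λ i → β * column j B i + γ * column j C i} {λ i → (A i ⊛ Y′) j} 1# (- η)
          (λ n → solve 3 (λ a η b → a :- η :* b := con 1ℚ :* a :+ (:- η) :* b) refl _ _ _) X i)
           (+-congʳ (*-congˡ (⊛-linearˡ {a₁ = column j B} {column j C} β γ (λ n → refl) X i)))) ⟩
    1# * (β * t₁ + γ * t₂) + - η * t₄ + ξ * t₃
      ≈⟨ solve 8 (λ β γ ξ η t₁ t₂ t₃ t₄ → con 1ℚ :* (β :* t₁ :+ γ :* t₂) :+ (:- η) :* t₄ :+ ξ :* t₃ := β :* t₁ :+ γ :* t₂ :+
          ξ :* t₃ :- η :* t₄)
           refl β γ ξ η t₁ t₂ t₃ t₄ ⟩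
    β * t₁ + γ * t₂ + ξ * t₃ - η * t₄ ∎
    where
    column : ℕ → Series₂ → Series
    column j A i = (A i ⊛ Y) j

    t₁ = twist B X Y i j
    t₂ = twist C X Y i j
    t₃ = twist A X′ Y i j
    t₄ = twist A X Y′ i j
    q  = ν (suc j) * twist A X Y i (suc j)

    -- `G i` is the coefficient of δ(A(x,y) Y(y)) at degrees i and j; `∂-column` verifies this.
    G : Series
    G i = β * column j B i + γ * column j C i - η * (A i ⊛ Y′) j

    ∂-row : ∀ i n → ∂ (A i) n ≈ ν (suc i) * A (suc i) n + - 1# * (β * B i n + γ * C i n)
    ∂-row i n = trans
      (solve 2 (λ p q → q := p :+ (:- con 1ℚ) :* (p :- q)) refl (ν (suc i) * A (suc i) n) (∂ (A i) n))
      (+-congˡ (*-congˡ (δA i n)))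

    ∂-column : ∀ i → ∂ (column j A) i ≈ ν (suc j) * column (suc j) A i + 1# * G i
    ∂-column i = sym (begin
      ∂ (A i ⊛ Y) j + 1# * G i
        ≈⟨ +-congʳ (∂-⊛ (A i) Y j) ⟩
      (∂ (A i) ⊛ Y) j + (A i ⊛ ∂ Y) j + 1# * G i
        ≈⟨ +-congʳ (+-cong
            (trans (⊛-linearˡ {a₁ = A (suc i)} {λ n → β * B i n + γ * C i n} (ν (suc i)) (- 1#) (∂-row i) Y j)
                   (+-congˡ (*-congˡ (⊛-linearˡ {a₁ = B i} {C i} β γ (λ n → refl) Y j))))
            (⊛-linearʳ {b₁ = Y′} {Y′} η 0# (λ n → trans (∂Y n) (solve 2 (λ ξ x → ξ :* x := ξ :* x :+ con 0ℚ :* x) refl η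
                (Y′ n))) (A i) j)) ⟩
      _ ≈⟨ solve 5 (λ p b y η g → p :+ (:- con 1ℚ) :* b :+ (η :* y :+ con 0ℚ :* y) :+ con 1ℚ :* (b :- η :* y) := p) refl
            (∂ (column j A) i) (β * column j B i + γ * column j C i) ((A i ⊛ Y′) j) η 0# ⟩
      ∂ (column j A) i ∎)

  twist-y≈0 : ∀ A X Y {y} → Y 0 ≈ y → ∀ n → twist A X Y n 0 ≈ y * ((λ i → A i 0) ⊛ X) n
  twist-y≈0 A X Y {y} Y₀≈y n = trans
    (⊛-linearˡ {a₁ = λ i → A i 0} {λ i → A i 0} y 0# (λ i → trans (+-congʳ (*-congˡ Y₀≈y))
      (solve 2 (λ a y → a :* y :+ con 0ℚ := y :* a :+ con 0ℚ :* a) refl (A i 0) y)) X n)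
    (solve 2 (λ a y → y :* a :+ con 0ℚ :* a := y :* a) refl (((λ i → A i 0) ⊛ X) n) y)

  twist-x≈0 : ∀ A X Y {x} → X 0 ≈ x → ∀ n → twist A X Y 0 n ≈ x * (A 0 ⊛ Y) n
  twist-x≈0 A X Y X₀≈x n = trans (+-identityʳ _) (trans (*-congˡ X₀≈x) (*-comm _ _))

  κ : ℕ → Carrier
  κ n = ι (_/_ (+ 1) (n !) {{n !≢0}})

  ν*κ : ∀ n → ν (suc n) * κ (suc n) ≈ κ n
  ν*κ n = begin
    ν (suc n) * κ (suc n)          ≈⟨ *-congʳ (ν≈ι (suc n)) ⟩
    ι (+ suc n / 1) * κ (suc n)    ≈⟨ ι-* _ _ ⟨
    ι ((+ suc n / 1) ℚ.* _)        ≡⟨ ≡.cong ι (suc*1/suc! n) ⟩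
    κ n                            ∎

  -- The hypothesis reads (i + 1) J(i + 1, j) = (j + 1) J(i, j + 1), so i! j! J(i, j) depends only
  -- on i + j. Here `φ` is the factorial in R, and `κ` inverts it.
  δ≈0⇒symmetric : ∀ J → (∀ i j → δ J i j ≈ 0#) → ∀ n → J n 0 ≈ J 0 n
  δ≈0⇒symmetric J δJ≈0 n = begin
    J n 0                 ≈⟨ cancel n (J n 0) ⟨
    κ n * (φ n * J n 0)   ≈⟨ *-congˡ (trans (*-congˡ (sym (*-identityˡ _))) (trans (slide n 0)
                                (≡.subst (λ m → 1# * (φ (n ℕ.+ 0) * J 0 (n ℕ.+ 0)) ≈ 1# * (φ m * J 0 m)) (ℕ.+-identityʳ n) refl))) ⟩
    κ n * (1# * (φ n * J 0 n)) ≈⟨ *-congˡ (*-identityˡ _) ⟩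
    κ n * (φ n * J 0 n)   ≈⟨ cancel n (J 0 n) ⟩
    J 0 n                 ∎
    where
    φ : ℕ → Carrier
    φ zero    = 1#
    φ (suc n) = ν (suc n) * φ n

    cancel : ∀ n x → κ n * (φ n * x) ≈ x
    cancel zero    x = trans (*-cong ι-1 (*-identityˡ x)) (*-identityˡ x)
    cancel (suc n) x = begin
      κ (suc n) * (ν (suc n) * φ n * x)    ≈⟨ solve 4 (λ k v p x → k :* (v :* p :* x) := v :* k :* (p :* x)) refl
          (κ (suc n)) (ν (suc n)) (φ n) x ⟩
      ν (suc n) * κ (suc n) * (φ n * x)    ≈⟨ *-congʳ (ν*κ n) ⟩
      κ n * (φ n * x)                      ≈⟨ cancel n x ⟩
      x                                    ∎

    slide : ∀ i j → φ i * (φ j * J i j) ≈ 1# * (φ (i ℕ.+ j) * J 0 (i ℕ.+ j))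
    slide zero    j = refl
    slide (suc i) j = begin
      ν (suc i) * φ i * (φ j * J (suc i) j)
        ≈⟨ solve 6 (λ ν φ ψ x μ y → ν :* φ :* (ψ :* x) := φ :* ψ :* (ν :* x :- μ :* y) :+ φ :* (μ :* ψ :* y)) refl
             (ν (suc i)) (φ i) (φ j) (J (suc i) j) (ν (suc j)) (J i (suc j)) ⟩
      φ i * φ j * δ J i j + φ i * (φ (suc j) * J i (suc j))
        ≈⟨ +-congʳ (trans (*-congˡ (δJ≈0 i j)) (zeroʳ _)) ⟩
      0# + φ i * (φ (suc j) * J i (suc j))
        ≈⟨ trans (+-identityˡ _) (slide i (suc j)) ⟩
      1# * (φ (i ℕ.+ suc j) * J 0 (i ℕ.+ suc j))
        ≡⟨ ≡.cong (λ m → 1# * (φ m * J 0 m)) (ℕ.+-suc i j) ⟩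
      1# * (φ (suc i ℕ.+ j) * J 0 (suc i ℕ.+ j)) ∎

  -- Exponential generating functions

  open Exponential ι

  egf≈ : ∀ a n → egf a n ≈ ι (a n / 1) * κ n
  egf≈ a n = begin
    egf a n             ≡⟨ ≡.cong ι (/-≡-*-/ (a n) (n !) {{n !≢0}}) ⟩
    ι ((a n / 1) ℚ.* (_/_ (+ 1) (n !) {{n !≢0}})) ≈⟨ ι-* (a n / 1) _ ⟩
    ι (a n / 1) * κ n   ∎

  -- The integer sequences behind the trigonometric series are local to their definitions. Once _/_ is
  -- abstracted to a variable, unification recovers them from the coefficients.

  IsEgf : Series → Set c
  IsEgf s = Σ (ℕ → ℤ) λ a → ∀ n → s n ≡ egf a n

  sin-egf : IsEgf sin
  sin-egf with _/_
  ... | _ = _ , λ n → ≡.refl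

  cos-egf : IsEgf cos
  cos-egf with _/_
  ... | _ = _ , λ n → ≡.refl

  sinh-egf : IsEgf sinh
  sinh-egf with _/_
  ... | _ = _ , λ n → ≡.refl

  cosh-egf : IsEgf cosh
  cosh-egf with _/_
  ... | _ = _ , λ n → ≡.refl

  ∂-egf : ∀ a b → (∀ n → a (suc n) ≡ b n) → ∂ (egf a) ≋ egf b
  ∂-egf a b eq n = begin
    ν (suc n) * egf a (suc n)                          ≈⟨ *-congˡ (egf≈ a (suc n)) ⟩
    ν (suc n) * (ι (a (suc n) / 1) * κ (suc n))        ≈⟨ solve 3 (λ v a k → v :* (a :* k) := a :* (v :* k)) refl _ _ _ ⟩
    ι (a (suc n) / 1) * (ν (suc n) * κ (suc n))        ≈⟨ *-cong (reflexive (≡.cong (λ z → ι (z / 1)) (eq n))) (ν*κ n) ⟩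
    ι (b n / 1) * κ n                                  ≈⟨ egf≈ b n ⟨
    egf b n                                            ∎

  egf-neg : ∀ a n → egf (ℤ.-_ ∘ a) n ≈ - egf a n
  egf-neg a n = trans (reflexive (≡.cong ι (neg-/ (a n) (n !) {{n !≢0}}))) (ι-neg _)

  ∂-sin : ∂ sin ≋ cos
  ∂-sin = ∂-egf (proj₁ sin-egf) (proj₁ cos-egf)
    (recurrence-unique ℤ.-_ (proj₁ sin-egf ∘ suc) (proj₁ cos-egf) (λ _ → ≡.refl) (λ _ → ≡.refl) ≡.refl ≡.refl)

  ∂-cos : ∀ n → ∂ cos n ≈ - sin n
  ∂-cos n = trans
    (∂-egf (proj₁ cos-egf) (ℤ.-_ ∘ proj₁ sin-egf)
      (recurrence-unique ℤ.-_ (proj₁ cos-egf ∘ suc) (ℤ.-_ ∘ proj₁ sin-egf) (λ _ → ≡.refl) (λ _ → ≡.refl) ≡.refl ≡.refl) n)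
    (egf-neg (proj₁ sin-egf) n)

  ∂-sinh : ∂ sinh ≋ cosh
  ∂-sinh = ∂-egf (proj₁ sinh-egf) (proj₁ cosh-egf)
    (recurrence-unique id (proj₁ sinh-egf ∘ suc) (proj₁ cosh-egf) (λ _ → ≡.refl) (λ _ → ≡.refl) ≡.refl ≡.refl)

  ∂-cosh : ∂ cosh ≋ sinh
  ∂-cosh = ∂-egf (proj₁ cosh-egf) (proj₁ sinh-egf)
    (recurrence-unique id (proj₁ cosh-egf ∘ suc) (proj₁ sinh-egf) (λ _ → ≡.refl) (λ _ → ≡.refl) ≡.refl ≡.refl)

  ∂-scale : ∀ r a n → ∂ (a [ r x]) n ≈ r * (∂ a [ r x]) n
  ∂-scale r a n = solve 4 (λ r p v a → v :* (r :* p :* a) := r :* (p :* (v :* a))) refl r _ _ _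

  egf₂ : (ℕ → ℕ → ℕ) → Series₂
  egf₂ g i j = ν (g i j) * (κ i * κ j)

  -- Since (i + 1) / (i + 1)! = 1 / i!, δ acts on these coefficients as the difference g(i + 1, j) -
  -- g(i, j + 1).
  δ-egf₂ : ∀ g p q → (∀ i j → g (suc i) j ℕ.+ p i j ≡ g i (suc j) ℕ.+ q i j) →
           ∀ i j → δ (egf₂ g) i j ≈ 1# * egf₂ q i j + - 1# * egf₂ p i j
  δ-egf₂ g p q eq i j = begin
    ν (suc i) * (u * (κ (suc i) * κ j)) - ν (suc j) * (v * (κ i * κ (suc j)))
      ≈⟨ solve 8 (λ ν ν′ u v k k′ l l′ → ν :* (u :* (k′ :* l)) :- ν′ :* (v :* (k :* l′)) := u :* (ν :* k′ :* l) :- v :*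
          (k :* (ν′ :* l′))) refl
           (ν (suc i)) (ν (suc j)) u v (κ i) (κ (suc i)) (κ j) (κ (suc j)) ⟩
    u * (ν (suc i) * κ (suc i) * κ j) - v * (κ i * (ν (suc j) * κ (suc j)))
      ≈⟨ +-cong (*-congˡ (*-congʳ (ν*κ i))) (-‿cong (*-congˡ (*-congˡ (ν*κ j)))) ⟩
    u * (κ i * κ j) - v * (κ i * κ j)
      -- Adding p to both terms makes the identity between natural numbers applicable.
      ≈⟨ solve 4 (λ u v p k → u :* k :- v :* k := (u :+ p) :* k :- (v :+ p) :* k) refl u v (ν (p i j)) (κ i * κ j) ⟩
    (u + ν (p i j)) * (κ i * κ j) - (v + ν (p i j)) * (κ i * κ j)
      ≈⟨ +-congʳ (*-congʳ (trans (sym (ν-+ (g (suc i) j) (p i j))) (trans (reflexive (≡.cong ν (eq i j)))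
          (ν-+ (g i (suc j)) (q i j))))) ⟩
    (v + ν (q i j)) * (κ i * κ j) - (v + ν (p i j)) * (κ i * κ j)
      ≈⟨ solve 4 (λ v p q k → (v :+ q) :* k :- (v :+ p) :* k := con 1ℚ :* (q :* k) :+ (:- con 1ℚ) :* (p :* k)) refl v
          (ν (p i j)) (ν (q i j)) (κ i * κ j) ⟩
    1# * egf₂ q i j + - 1# * egf₂ p i j ∎
    where
    u = ν (g (suc i) j)
    v = ν (g i (suc j))

  -- The conservation law

  linear : Carrier → Series₂ → Carrier → Series₂ → Series₂
  linear x A y B i j = x * A i j + y * B i j

  δ-linear : ∀ x A y B {p q} i j → δ A i j ≈ p → δ B i j ≈ q → δ (linear x A y B) i j ≈ x * p + y * q
  δ-linear x A y B {p} {q} i j δA≈p δB≈q = trans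
    (solve 8 (λ x y ν μ a a′ b b′ → ν :* (x :* a :+ y :* b) :- μ :* (x :* a′ :+ y :* b′) :=
                                     x :* (ν :* a :- μ :* a′) :+ y :* (ν :* b :- μ :* b′)) refl
      x y (ν (suc i)) (ν (suc j)) (A (suc i) j) (A i (suc j)) (B (suc i) j) (B i (suc j)))
    (+-cong (*-congˡ δA≈p) (*-congˡ δB≈q))

  U Z Ū Z̄ : Series₂
  U = egf₂ (entry true  false)
  Z = egf₂ (entry true  true)
  Ū = egf₂ (entry false false)
  Z̄ = egf₂ (entry false true)

  -- Each is `ι` of a rational, the form to which the solver's constants reduce.
  -½ 3/2 -2ᴿ 3ᴿ -3ᴿ ½ᴿ : Carrier
  -½  = ι (-[1+ 0 ] / 2)
  3/2 = ι (+ 3 / 2)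
  -2ᴿ = ι (-[1+ 1 ] / 1)
  3ᴿ  = ι (+ 3 / 1)
  -3ᴿ = ι (-[1+ 2 ] / 1)
  ½ᴿ  = ι ½

  δ-U : ∀ i j → δ U i j ≈ 1# * Ū i j + - 1# * Z̄ i j
  δ-U = δ-egf₂ (entry true false) (entry false true) (entry false false) (entry-true false)

  δ-Z : ∀ i j → δ Z i j ≈ 1# * Ū i j + 0# * Ū i j
  δ-Z i j = trans (δ-egf₂ (entry true true) (λ _ _ → 0) (entry false false) (entry-true true) i j)
    (solve 2 (λ u k → con 1ℚ :* u :+ (:- con 1ℚ) :* (con 0ℚ :* k) := con 1ℚ :* u :+ con 0ℚ :* u) refl (Ū i j) (κ i * κ j))

  δ-Ū : ∀ i j → δ Ū i j ≈ 1# * Z i j + - 1# * U i j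
  δ-Ū = δ-egf₂ (entry false false) (entry true false) (entry true true) (entry-false false)

  δ-Z̄ : ∀ i j → δ Z̄ i j ≈ - 1# * U i j + 0# * U i j
  δ-Z̄ i j = trans (δ-egf₂ (entry false true) (entry true false) (λ _ _ → 0) (entry-false true) i j)
    (solve 2 (λ u k → con 1ℚ :* (con 0ℚ :* k) :+ (:- con 1ℚ) :* u := (:- con 1ℚ) :* u :+ con 0ℚ :* u) refl (U i j) (κ i * κ j))

  U-max : ∀ n → U n 0 ≈ F n
  U-max n = begin
    ν (entry true false n 0) * (κ n * κ 0)   ≡⟨ ≡.cong (λ k → ν k * (κ n * κ 0)) (entry-true-max false n) ⟩
    ν (f n) * (κ n * κ 0)                    ≈⟨ *-cong (ν≈ι (f n)) (trans (*-congˡ ι-1) (*-identityʳ _)) ⟩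
    ι (+ f n / 1) * κ n                      ≈⟨ egf≈ (λ n → + f n) n ⟨
    F n                                      ∎

  Z-max : ∀ n → Z n 0 ≈ F n
  Z-max n = trans (reflexive (≡.cong (λ k → ν k * (κ n * κ 0))
    (≡.trans (entry-true-max true n) (≡.sym (entry-true-max false n))))) (U-max n)

  Z̄-min : ∀ n → Z̄ 0 n ≈ F n
  Z̄-min n = trans (*-cong (reflexive (≡.cong ν (≡.trans (entry-false-min n) (≡.sym (entry-true-max false n)))))
      (*-comm _ _)) (U-max n)

  Z-min : ∀ n → Z 0 n ≈ 1ˢ n
  Z-min zero    = trans (*-cong (+-identityʳ 1#) (trans (*-cong ι-1 ι-1) (*-identityˡ 1#))) (*-identityˡ 1#)
  Z-min (suc n) = trans (*-congʳ (reflexive (≡.cong ν (entry-true-min n)))) (zeroˡ _)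

  Z̄-max : ∀ n → Z̄ n 0 ≈ 1ˢ n
  Z̄-max zero    = trans (*-cong (+-identityʳ 1#) (trans (*-cong ι-1 ι-1) (*-identityˡ 1#))) (*-identityˡ 1#)
  Z̄-max (suc n) = trans (*-congʳ (reflexive (≡.cong ν (entry-false-max n)))) (zeroˡ _)

  module _ (√3 : Carrier) (√3² : √3 * √3 ≈ 3ᴿ) where

    -- Absorbing √3 into the hyperbolic sine gives C′ = S/2 and S′ = 3C/2, with rational
    -- coefficients. The relation `√3²` enters only in the second.
    cosˣ sinˣ coshˣ sinhˣ √3sinhˣ : Series
    cosˣ    = cos [ ½ᴿ x]
    sinˣ    = sin [ ½ᴿ x]
    coshˣ   = cosh [ ½ᴿ * √3 x]
    sinhˣ   = sinh [ ½ᴿ * √3 x]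
    √3sinhˣ = √3 · sinhˣ

    ∂-cosˣ : ∀ n → ∂ cosˣ n ≈ -½ * sinˣ n
    ∂-cosˣ n = begin
      ∂ cosˣ n                    ≈⟨ ∂-scale ½ᴿ cos n ⟩
      ½ᴿ * (½ᴿ ^ n * ∂ cos n)     ≈⟨ *-congˡ (*-congˡ (∂-cos n)) ⟩
      ½ᴿ * (½ᴿ ^ n * - sin n)     ≈⟨ solve 2 (λ p s → con ½ :* (p :* (:- s)) := con (-[1+ 0 ] / 2) :* (p :* s)) refl
          (½ᴿ ^ n) (sin n) ⟩
      -½ * sinˣ n                 ∎

    ∂-sinˣ : ∀ n → ∂ sinˣ n ≈ ½ᴿ * cosˣ n
    ∂-sinˣ n = trans (∂-scale ½ᴿ sin n) (*-congˡ (*-congˡ (∂-sin n)))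

    ∂-coshˣ : ∀ n → ∂ coshˣ n ≈ ½ᴿ * √3sinhˣ n
    ∂-coshˣ n = trans (∂-scale (½ᴿ * √3) cosh n) (trans (*-congˡ (*-congˡ (∂-cosh n))) (*-assoc _ _ _))

    ∂-√3sinhˣ : ∀ n → ∂ √3sinhˣ n ≈ 3/2 * coshˣ n
    ∂-√3sinhˣ n = begin
      ν (suc n) * (√3 * sinhˣ (suc n))
        ≈⟨ solve 3 (λ a b d → a :* (b :* d) := b :* (a :* d)) refl (ν (suc n)) √3 (sinhˣ (suc n)) ⟩
      √3 * ∂ sinhˣ n
        ≈⟨ *-congˡ (trans (∂-scale (½ᴿ * √3) sinh n) (*-congˡ (*-congˡ (∂-sinh n)))) ⟩
      √3 * (½ᴿ * √3 * coshˣ n)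
        ≈⟨ solve 2 (λ r d → r :* (con ½ :* r :* d) := con ½ :* (r :* r) :* d) refl √3 (coshˣ n) ⟩
      ½ᴿ * (√3 * √3) * coshˣ n
        ≈⟨ *-congʳ (*-congˡ √3²) ⟩
      ½ᴿ * 3ᴿ * coshˣ n
        ≈⟨ *-congʳ (sym (ι-* ½ (+ 3 / 1))) ⟩
      3/2 * coshˣ n ∎

    J₁ J₂ J₃ J₄ J₅ J₆ J : Series₂
    J₁ = twist U √3sinhˣ cosˣ
    J₂ = twist Z √3sinhˣ cosˣ
    J₃ = twist Z coshˣ sinˣ
    J₄ = twist Ū √3sinhˣ sinˣ
    J₅ = twist Z̄ √3sinhˣ sinˣ
    J₆ = twist Z̄ coshˣ cosˣ
    J  = linear 1# (linear -2ᴿ J₁ 1# J₂)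
                1# (linear 3ᴿ J₃ 1# (linear -2ᴿ J₄ 1# (linear 1# J₅ -3ᴿ J₆)))

    -- The product rule expresses δJ through eight products, and the weights in `J` make the
    -- coefficient of each of them vanish.
    δ-J : ∀ i j → δ J i j ≈ 0#
    δ-J i j = trans
      (δ-linear 1# (linear -2ᴿ J₁ 1# J₂) 1# (linear 3ᴿ J₃ 1# (linear -2ᴿ J₄ 1# (linear 1# J₅ -3ᴿ J₆))) i j
        (δ-linear -2ᴿ J₁ 1# J₂ i j
          (δ-twist {U} {Ū} {Z̄} {√3sinhˣ} {coshˣ} {cosˣ} {sinˣ} 1# (- 1#) 3/2 -½ δ-U ∂-√3sinhˣ ∂-cosˣ i j)
          (δ-twist {Z} {Ū} {Ū} {√3sinhˣ} {coshˣ} {cosˣ} {sinˣ} 1# 0# 3/2 -½ δ-Z ∂-√3sinhˣ ∂-cosˣ i j))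
        (δ-linear 3ᴿ J₃ 1# (linear -2ᴿ J₄ 1# (linear 1# J₅ -3ᴿ J₆)) i j
          (δ-twist {Z} {Ū} {Ū} {coshˣ} {√3sinhˣ} {sinˣ} {cosˣ} 1# 0# ½ᴿ ½ᴿ δ-Z ∂-coshˣ ∂-sinˣ i j)
          (δ-linear -2ᴿ J₄ 1# (linear 1# J₅ -3ᴿ J₆) i j
            (δ-twist {Ū} {Z} {U} {√3sinhˣ} {coshˣ} {sinˣ} {cosˣ} 1# (- 1#) 3/2 ½ᴿ δ-Ū ∂-√3sinhˣ ∂-sinˣ i j)
            (δ-linear 1# J₅ -3ᴿ J₆ i j
              (δ-twist {Z̄} {U} {U} {√3sinhˣ} {coshˣ} {sinˣ} {cosˣ} (- 1#) 0# 3/2 ½ᴿ δ-Z̄ ∂-√3sinhˣ ∂-sinˣ i j)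
              (δ-twist {Z̄} {U} {U} {coshˣ} {√3sinhˣ} {cosˣ} {sinˣ} (- 1#) 0# ½ᴿ -½ δ-Z̄ ∂-coshˣ ∂-cosˣ i j)))))
      -- The first small letter names the factor in x, `t` for `√3sinhˣ` and `c` for `coshˣ`; the
      -- second names the factor in y, `c` for `cosˣ` and `s` for `sinˣ`.
      (solve 8 (λ Ūtc Z̄tc Ucc Uts Zcc Zts Ūcs Z̄cs →
        con 1ℚ :* (con (-[1+ 1 ] / 1) :* (con 1ℚ :* Ūtc :+ (:- con 1ℚ) :* Z̄tc :+ con (+ 3 / 2) :* Ucc :- con (-[1+ 0 ] / 2) :* Uts)
                   :+ con 1ℚ :* (con 1ℚ :* Ūtc :+ con 0ℚ :* Ūtc :+ con (+ 3 / 2) :* Zcc :- con (-[1+ 0 ] / 2) :* Zts))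
        :+ con 1ℚ :* (con (+ 3 / 1) :* (con 1ℚ :* Ūcs :+ con 0ℚ :* Ūcs :+ con ½ :* Zts :- con ½ :* Zcc)
                   :+ con 1ℚ :* (con (-[1+ 1 ] / 1) :* (con 1ℚ :* Zts :+ (:- con 1ℚ) :* Uts :+ con (+ 3 / 2) :* Ūcs :- con ½ :* Ūtc)
                   :+ con 1ℚ :* (con 1ℚ :* ((:- con 1ℚ) :* Uts :+ con 0ℚ :* Uts :+ con (+ 3 / 2) :* Z̄cs :- con ½ :* Z̄tc)
                   :+ con (-[1+ 2 ] / 1) :* ((:- con 1ℚ) :* Ucc :+ con 0ℚ :* Ucc :+ con ½ :* Z̄tc :- con (-[1+ 0 ] / 2) :* Z̄cs))))
        := con 0ℚ) refl
        (twist Ū √3sinhˣ cosˣ i j) (twist Z̄ √3sinhˣ cosˣ i j) (twist U coshˣ cosˣ i j) (twist U √3sinhˣ sinˣ i j)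
        (twist Z coshˣ cosˣ i j) (twist Z √3sinhˣ sinˣ i j) (twist Ū coshˣ sinˣ i j) (twist Z̄ coshˣ sinˣ i j))

    -- Boundary values of the invariant, and the quotient.

    cosˣ₀ : cosˣ 0 ≈ 1#
    cosˣ₀ = trans (*-congˡ ι-1) (*-identityˡ 1#)

    sinˣ₀ : sinˣ 0 ≈ 0#
    sinˣ₀ = trans (*-congˡ ι-0) (zeroʳ _)

    coshˣ₀ : coshˣ 0 ≈ 1#
    coshˣ₀ = trans (*-congˡ ι-1) (*-identityˡ 1#)

    √3sinhˣ₀ : √3sinhˣ 0 ≈ 0#
    √3sinhˣ₀ = trans (*-congˡ (trans (*-congˡ ι-0) (zeroʳ _))) (zeroʳ _)

    -- At y = 0 the sine terms vanish and the cosine is 1. Both U and Z become F, so Z - 2U becomes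
    -- -F, while Z̄ becomes 1.
    J-y≈0 : ∀ n → J n 0 ≈ - (F ⊛ √3sinhˣ) n - 3ᴿ * coshˣ n
    J-y≈0 n = trans
      (+-cong (*-congˡ (+-cong
          (*-congˡ (trans (twist-y≈0 U √3sinhˣ cosˣ cosˣ₀ n) (*-congˡ (⊛-congʳ √3sinhˣ U-max n))))
          (*-congˡ (trans (twist-y≈0 Z √3sinhˣ cosˣ cosˣ₀ n) (*-congˡ (⊛-congʳ √3sinhˣ Z-max n))))))
        (*-congˡ (+-cong
          (*-congˡ (twist-y≈0 Z coshˣ sinˣ sinˣ₀ n))
          (*-congˡ (+-cong
            (*-congˡ (twist-y≈0 Ū √3sinhˣ sinˣ sinˣ₀ n))
            (*-congˡ (+-cong
              (*-congˡ (twist-y≈0 Z̄ √3sinhˣ sinˣ sinˣ₀ n))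
              (*-congˡ (trans (twist-y≈0 Z̄ coshˣ cosˣ cosˣ₀ n)
                (*-congˡ (trans (⊛-congʳ coshˣ Z̄-max n) (⊛-identityˡ coshˣ n))))))))))))
      (solve 5 (λ a b d e g →
        con 1ℚ :* (con (-[1+ 1 ] / 1) :* (con 1ℚ :* a) :+ con 1ℚ :* (con 1ℚ :* a))
        :+ con 1ℚ :* (con (+ 3 / 1) :* (con 0ℚ :* b) :+ con 1ℚ :* (con (-[1+ 1 ] / 1) :* (con 0ℚ :* d)
        :+ con 1ℚ :* (con 1ℚ :* (con 0ℚ :* e) :+ con (-[1+ 2 ] / 1) :* (con 1ℚ :* g))))
        := :- a :- con (+ 3 / 1) :* g) refl _ _ _ _ _)

    -- At x = 0 only the two terms with `coshˣ` survive, where Z is 1 and Z̄ is F.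
    J-x≈0 : ∀ n → J 0 n ≈ 3ᴿ * sinˣ n - 3ᴿ * (F ⊛ cosˣ) n
    J-x≈0 n = trans
      (+-cong (*-congˡ (+-cong
          (*-congˡ (twist-x≈0 U √3sinhˣ cosˣ √3sinhˣ₀ n))
          (*-congˡ (twist-x≈0 Z √3sinhˣ cosˣ √3sinhˣ₀ n))))
        (*-congˡ (+-cong
          (*-congˡ (trans (twist-x≈0 Z coshˣ sinˣ coshˣ₀ n)
            (*-congˡ (trans (⊛-congʳ sinˣ Z-min n) (⊛-identityˡ sinˣ n)))))
          (*-congˡ (+-cong
            (*-congˡ (twist-x≈0 Ū √3sinhˣ sinˣ √3sinhˣ₀ n))
            (*-congˡ (+-cong
              (*-congˡ (twist-x≈0 Z̄ √3sinhˣ sinˣ √3sinhˣ₀ n))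
              (*-congˡ (trans (twist-x≈0 Z̄ coshˣ cosˣ coshˣ₀ n) (*-congˡ (⊛-congʳ cosˣ Z̄-min n)))))))))))
      (solve 6 (λ a b s d e g →
        con 1ℚ :* (con (-[1+ 1 ] / 1) :* (con 0ℚ :* a) :+ con 1ℚ :* (con 0ℚ :* b))
        :+ con 1ℚ :* (con (+ 3 / 1) :* (con 1ℚ :* s) :+ con 1ℚ :* (con (-[1+ 1 ] / 1) :* (con 0ℚ :* d)
        :+ con 1ℚ :* (con 1ℚ :* (con 0ℚ :* e) :+ con (-[1+ 2 ] / 1) :* (con 1ℚ :* g))))
        := con (+ 3 / 1) :* s :- con (+ 3 / 1) :* g) refl _ _ _ _ _ _)

    numerator denominator : Series
    numerator   = 3ᴿ · sinˣ ⊕ 3ᴿ · coshˣ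
    denominator = 3ᴿ · cosˣ ⊖ √3sinhˣ

    F⊛denominator : F ⊛ denominator ≋ numerator
    F⊛denominator n = begin
      (F ⊛ denominator) n
        ≈⟨ ⊛-linearʳ {b₁ = cosˣ} {√3sinhˣ} 3ᴿ (- 1#) (λ m → solve 2 (λ p q → p :- q := p :+ (:- con 1ℚ) :* q) refl
            (3ᴿ * cosˣ m) (√3sinhˣ m)) F n ⟩
      3ᴿ * (F ⊛ cosˣ) n + - 1# * (F ⊛ √3sinhˣ) n
        -- Adding and subtracting 3C exhibits J(t,0), to be exchanged for J(0,t).
        ≈⟨ solve 3 (λ a b d → con (+ 3 / 1) :* a :+ (:- con 1ℚ) :* b :=
             (:- b :- con (+ 3 / 1) :* d) :+ con (+ 3 / 1) :* a :+ con (+ 3 / 1) :* d) refl ((F ⊛ cosˣ) n) ((F ⊛ √3sinhˣ) n)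
                 (coshˣ n) ⟩
      - (F ⊛ √3sinhˣ) n - 3ᴿ * coshˣ n + 3ᴿ * (F ⊛ cosˣ) n + 3ᴿ * coshˣ n
        ≈⟨ +-congʳ (+-congʳ (trans (sym (J-y≈0 n)) (trans (δ≈0⇒symmetric J δ-J n) (J-x≈0 n)))) ⟩
      3ᴿ * sinˣ n - 3ᴿ * (F ⊛ cosˣ) n + 3ᴿ * (F ⊛ cosˣ) n + 3ᴿ * coshˣ n
        ≈⟨ solve 3 (λ s a d → s :- a :+ a :+ d := s :+ d) refl (3ᴿ * sinˣ n) (3ᴿ * (F ⊛ cosˣ) n) (3ᴿ * coshˣ n) ⟩
      3ᴿ * sinˣ n + 3ᴿ * coshˣ n ∎

    -- The constant term is 3, whose inverse is the image of 1/3; long division requires no other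
    -- inverse in R.
    ⅓*denominator₀ : ι (+ 1 / 3) * denominator 0 ≈ 1#
    ⅓*denominator₀ = trans
      (*-congˡ (+-cong (*-congˡ cosˣ₀) (-‿cong √3sinhˣ₀)))
      (solve 0 (con (+ 1 / 3) :* (con (+ 3 / 1) :* con 1ℚ :- con 0ℚ) := con 1ℚ) refl)

    F≋numerator÷denominator : F ≋ numerator ÷ denominator
    F≋numerator÷denominator = Division.⊛⇒÷ denominator (ι (+ 1 / 3)) ⅓*denominator₀ F⊛denominator

theorem1 :
    ∀ {c ℓ} (R : CommutativeRing c ℓ) →
    let open CommutativeRing R
        open PowerSeries R in
    (ι : ℚ → Carrier) →
    RingMorphisms.IsRingHomomorphism +-*-rawRing rawRing ι →
    (√3 : Carrier) → √3 * √3 ≈ ι (+ 3 / 1) →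
    let open Exponential ι
        3ᴿ = ι (+ 3 / 1)
        ½ᴿ = ι ½ in
    F ≋ (3ᴿ · sin [ ½ᴿ x] ⊕ 3ᴿ · cosh [ ½ᴿ * √3 x])
      ÷ (3ᴿ · cos [ ½ᴿ x] ⊖ √3 · sinh [ ½ᴿ * √3 x])
theorem1 R ι ι-hom √3 √3² = Analysis.F≋numerator÷denominator R ι ι-hom √3 √3²
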